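{- Let $\mathbb{C}$ be a ribbon category and $A$ a reflexive object of $\mathbb{C}$ (with isomorphism $\varphi:A\otimes A^*\to A$), and suppose $\mathrm{Tr}^A_{I,I}(\mathrm{id}_A)=\mathrm{id}_I$. Then the assignment $A^{\otimes m}\mapsto m$, $f\mapsto F(f)$ is a functor $F:\mathbb{C}|_A\to\mathcal{I}_{\mathcal{A}}$ which is full and faithful and gives an equivalence between $\mathbb{C}|_A$ and $\mathcal{I}_{\mathcal{A}}$.
   Context: Ribbon category: a (strict) braided monoidal category with braid $\sigma_{X,Y}:X\otimes Y\to Y\otimes X$, natural twist isomorphism $\theta$ with $\theta_{X\otimes Y}=\sigma_{X,Y};(\theta_Y\otimes\theta_X);\sigma_{Y,X}$, every object $X$ having a chosen left dual $X^*$ with unit $\eta_X:I\to X\otimes X^*$, counit $\varepsilon_X:X^*\otimes X\to I$ satisfying the snake equations, and $(\theta_X)^*=\theta_{X^*}$; composition $f;g$ is diagrammatic ($f$ first). Trace: $\mathrm{Tr}^X_{U,V}(f)=(U\otimes\eta_X);(f\otimes X^*);(V\otimes(\sigma_{X,X^*};(X^*\otimes\theta_X);\varepsilon_X))$ for $f:U\otimes X\to V\otimes X$. A reflexive object is an object $A$ with an isomorphism $\varphi:A\otimes A^*\to A$. $\mathbb{C}|_A$ is the full subcategory on the objects $A^{\otimes m}$, $m\ge 0$. Define $\mathbf{app}:=(\varphi^{ -1}\otimes A);(A\otimes\varepsilon_A):A\otimes A\to A$; $\mathbf{lam}:=(A\otimes\eta_A);(A\otimes A\otimes\theta_{A^*}^{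 -1});(A\otimes\sigma^{ -1}_{A^*,A});(\varphi\otimes A):A\to A\otimes A$; $\mathbf{app}_0=\mathrm{id}_A$, $\mathbf{app}_{n+1}=(\mathbf{app}\otimes A^{\otimes n});\mathbf{app}_n:A^{\otimes(n+2)}\to A$; $\mathbf{lam}_0=\mathrm{id}_A$, $\mathbf{lam}_{m+1}=\mathbf{lam}_m;(\mathbf{lam}\otimes A^{\otimes m}):A\to A^{\otimes(m+2)}$; for $f:A^{\otimes m}\to A^{\otimes n}$, $F(f):=\mathrm{Tr}^A_{I,A}(\mathbf{lam}_m;(\mathbf{lam}\otimes f);(A\otimes\mathbf{app}_n)):I\to A$. Let $\mathcal{A}=\mathbb{C}(I,A)$ with application $a\,b:=(a\otimes b);\mathbf{app}$ (left-associative), and elements $\mathbf{B}:=F(\mathbf{app})$, $\mathbf{C}^+:=F(\sigma_{A,A})$, $\mathbf{I}:=F(\mathrm{id}_I)$. Write $a\circ b:=\mathbf{B}\,a\,b$, $a^0:=\mathbf{I}$, $a^{n+1}:=a\circ a^n$, $a^\bullet:=\mathbf{C}^+\,\mathbf{I}\,a$; $a$ has arity $m\to n$ if $a^\bullet\circ\mathbf{B}^{m+1}=(\mathbf{B}\,a)\circ\mathbf{B}^n$. The internal PROB $\mathcal{I}_{\mathcal{A}}$ is the category whose objects are the natural numbers, whose morphisms $m\to n$ are the elements of arity $m\to n$, with composite of $a:l\to m$ and $b:m\to n$ equal to $a\circ b$ and identities $\mathbf{I}$. -}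

module Defs where

open import Level using (Level; _⊔_) renaming (suc to lsuc)
open import Data.Nat using (ℕ; zero; suc)
open import Data.Product using (Σ)
open import Relation.Binary.Structures using (IsEquivalence)

record Category (o ℓ e : Level) : Set (lsuc (o ⊔ ℓ ⊔ e)) where
  infix  4 _≈_
  infixr 9 _⨾_
  field
    Obj : Set o
    _⇒_ : Obj → Obj → Set ℓ
    _≈_ : ∀ {X Y} → X ⇒ Y → X ⇒ Y → Set e
    id  : ∀ {X} → X ⇒ X
    _⨾_ : ∀ {X Y Z} → X ⇒ Y → Y ⇒ Z → X ⇒ Z
    ≈-isEquivalence : ∀ {X Y} → IsEquivalence (_≈_ {X} {Y})
    ⨾-resp-≈ : ∀ {X Y Z} {f f′ : X ⇒ Y} {g g′ : Y ⇒ Z} →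
               f ≈ f′ → g ≈ g′ → f ⨾ g ≈ f′ ⨾ g′
    identityˡ : ∀ {X Y} {f : X ⇒ Y} → id ⨾ f ≈ f
    identityʳ : ∀ {X Y} {f : X ⇒ Y} → f ⨾ id ≈ f
    assoc : ∀ {W X Y Z} {f : W ⇒ X} {g : X ⇒ Y} {h : Y ⇒ Z} →
            (f ⨾ g) ⨾ h ≈ f ⨾ (g ⨾ h)

record Monoidal {o ℓ e} (C : Category o ℓ e) : Set (o ⊔ ℓ ⊔ e) where
  open Category C
  infixr 10 _⊗₀_ _⊗₁_
  field
    unit : Obj
    _⊗₀_ : Obj → Obj → Obj
    _⊗₁_ : ∀ {X Y Z W} → X ⇒ Y → Z ⇒ W → (X ⊗₀ Z) ⇒ (Y ⊗₀ W)
    ⊗-identity : ∀ {X Y} → id {X} ⊗₁ id {Y} ≈ id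
    ⊗-homomorphism : ∀ {X₁ Y₁ Z₁ X₂ Y₂ Z₂}
                       {f₁ : X₁ ⇒ Y₁} {g₁ : Y₁ ⇒ Z₁} {f₂ : X₂ ⇒ Y₂} {g₂ : Y₂ ⇒ Z₂} →
                     (f₁ ⨾ g₁) ⊗₁ (f₂ ⨾ g₂) ≈ (f₁ ⊗₁ f₂) ⨾ (g₁ ⊗₁ g₂)
    ⊗-resp-≈ : ∀ {X Y Z W} {f f′ : X ⇒ Y} {g g′ : Z ⇒ W} →
               f ≈ f′ → g ≈ g′ → f ⊗₁ g ≈ f′ ⊗₁ g′
    α⇒ : ∀ X Y Z → ((X ⊗₀ Y) ⊗₀ Z) ⇒ (X ⊗₀ (Y ⊗₀ Z))
    α⇐ : ∀ X Y Z → (X ⊗₀ (Y ⊗₀ Z)) ⇒ ((X ⊗₀ Y) ⊗₀ Z)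
    α-isoˡ : ∀ X Y Z → α⇒ X Y Z ⨾ α⇐ X Y Z ≈ id
    α-isoʳ : ∀ X Y Z → α⇐ X Y Z ⨾ α⇒ X Y Z ≈ id
    α-natural : ∀ {X X′ Y Y′ Z Z′} (f : X ⇒ X′) (g : Y ⇒ Y′) (h : Z ⇒ Z′) →
                ((f ⊗₁ g) ⊗₁ h) ⨾ α⇒ X′ Y′ Z′ ≈ α⇒ X Y Z ⨾ (f ⊗₁ (g ⊗₁ h))
    lu⇒ : ∀ X → (unit ⊗₀ X) ⇒ X
    lu⇐ : ∀ X → X ⇒ (unit ⊗₀ X)
    lu-isoˡ : ∀ X → lu⇒ X ⨾ lu⇐ X ≈ id
    lu-isoʳ : ∀ X → lu⇐ X ⨾ lu⇒ X ≈ id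
    lu-natural : ∀ {X Y} (f : X ⇒ Y) → (id {unit} ⊗₁ f) ⨾ lu⇒ Y ≈ lu⇒ X ⨾ f
    ru⇒ : ∀ X → (X ⊗₀ unit) ⇒ X
    ru⇐ : ∀ X → X ⇒ (X ⊗₀ unit)
    ru-isoˡ : ∀ X → ru⇒ X ⨾ ru⇐ X ≈ id
    ru-isoʳ : ∀ X → ru⇐ X ⨾ ru⇒ X ≈ id
    ru-natural : ∀ {X Y} (f : X ⇒ Y) → (f ⊗₁ id {unit}) ⨾ ru⇒ Y ≈ ru⇒ X ⨾ f
    pentagon : ∀ W X Y Z →
               (α⇒ W X Y ⊗₁ id {Z}) ⨾ α⇒ W (X ⊗₀ Y) Z ⨾ (id {W} ⊗₁ α⇒ X Y Z)
                 ≈ α⇒ (W ⊗₀ X) Y Z ⨾ α⇒ W X (Y ⊗₀ Z)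
    triangle : ∀ X Y → α⇒ X unit Y ⨾ (id {X} ⊗₁ lu⇒ Y) ≈ ru⇒ X ⊗₁ id {Y}

record Braided {o ℓ e} {C : Category o ℓ e} (M : Monoidal C) : Set (o ⊔ ℓ ⊔ e) where
  open Category C
  open Monoidal M
  field
    σ   : ∀ X Y → (X ⊗₀ Y) ⇒ (Y ⊗₀ X)
    σ⁻¹ : ∀ X Y → (Y ⊗₀ X) ⇒ (X ⊗₀ Y)
    σ-isoˡ : ∀ X Y → σ X Y ⨾ σ⁻¹ X Y ≈ id
    σ-isoʳ : ∀ X Y → σ⁻¹ X Y ⨾ σ X Y ≈ id
    σ-natural : ∀ {X X′ Y Y′} (f : X ⇒ X′) (g : Y ⇒ Y′) →
                (f ⊗₁ g) ⨾ σ X′ Y′ ≈ σ X Y ⨾ (g ⊗₁ f)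
    hexagon₁ : ∀ X Y Z →
               α⇒ X Y Z ⨾ σ X (Y ⊗₀ Z) ⨾ α⇒ Y Z X
                 ≈ (σ X Y ⊗₁ id {Z}) ⨾ α⇒ Y X Z ⨾ (id {Y} ⊗₁ σ X Z)
    hexagon₂ : ∀ X Y Z →
               α⇐ X Y Z ⨾ σ (X ⊗₀ Y) Z ⨾ α⇐ Z X Y
                 ≈ (id {X} ⊗₁ σ Y Z) ⨾ α⇐ X Z Y ⨾ (σ X Z ⊗₁ id {Y})

record LeftRigid {o ℓ e} {C : Category o ℓ e} (M : Monoidal C) : Set (o ⊔ ℓ ⊔ e) where
  open Category C
  open Monoidal M
  infix 15 _*
  field
    _* : Obj → Obj
    η  : ∀ X → unit ⇒ (X ⊗₀ X *)
    ε  : ∀ X → (X * ⊗₀ X) ⇒ unit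
    snake₁ : ∀ X → lu⇐ X ⨾ (η X ⊗₁ id {X}) ⨾ α⇒ X (X *) X ⨾ (id {X} ⊗₁ ε X) ⨾ ru⇒ X ≈ id
    snake₂ : ∀ X → ru⇐ (X *) ⨾ (id {X *} ⊗₁ η X) ⨾ α⇐ (X *) X (X *) ⨾ (ε X ⊗₁ id {X *}) ⨾ lu⇒ (X *) ≈ id

module _ {o ℓ e} {C : Category o ℓ e} {M : Monoidal C} (D : LeftRigid M) where
  open Category C
  open Monoidal M
  open LeftRigid D

  dualMor : ∀ {X Y} → X ⇒ Y → (Y *) ⇒ (X *)
  dualMor {X} {Y} f =
    ru⇐ (Y *) ⨾ (id {Y *} ⊗₁ η X) ⨾ α⇐ (Y *) X (X *) ⨾ ((id {Y *} ⊗₁ f) ⊗₁ id {X *})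
      ⨾ (ε Y ⊗₁ id {X *}) ⨾ lu⇒ (X *)

record Twist {o ℓ e} {C : Category o ℓ e} {M : Monoidal C}
             (B : Braided M) (D : LeftRigid M) : Set (o ⊔ ℓ ⊔ e) where
  open Category C
  open Monoidal M
  open Braided B
  open LeftRigid D
  field
    θ   : ∀ X → X ⇒ X
    θ⁻¹ : ∀ X → X ⇒ X
    θ-isoˡ : ∀ X → θ X ⨾ θ⁻¹ X ≈ id
    θ-isoʳ : ∀ X → θ⁻¹ X ⨾ θ X ≈ id
    θ-natural : ∀ {X Y} (f : X ⇒ Y) → f ⨾ θ Y ≈ θ X ⨾ f
    θ-balance : ∀ X Y → θ (X ⊗₀ Y) ≈ σ X Y ⨾ (θ Y ⊗₁ θ X) ⨾ σ Y X
    θ-dual : ∀ X → dualMor D (θ X) ≈ θ (X *)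

record RibbonCategory (o ℓ e : Level) : Set (lsuc (o ⊔ ℓ ⊔ e)) where
  field
    category : Category o ℓ e
    monoidal : Monoidal category
    braided  : Braided monoidal
    rigid    : LeftRigid monoidal
    twist    : Twist braided rigid

module RibbonOps {o ℓ e} (R : RibbonCategory o ℓ e) where
  open RibbonCategory R public
  open Category category public
  open Monoidal monoidal public
  open Braided braided public
  open LeftRigid rigid public
  open Twist twist public

record ReflexiveObject {o ℓ e} (R : RibbonCategory o ℓ e) : Set (o ⊔ ℓ ⊔ e) where
  open RibbonOps R
  field
    A   : Obj
    φ   : (A ⊗₀ A *) ⇒ A
    φ⁻¹ : A ⇒ (A ⊗₀ A *)
    φ-isoˡ : φ ⨾ φ⁻¹ ≈ id
    φ-isoʳ : φ⁻¹ ⨾ φ ≈ id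

-- The constructions of the paper (coherence isomorphisms inserted where the
-- paper works strictly)

module Internal {o ℓ e} (R : RibbonCategory o ℓ e) (RA : ReflexiveObject R) where
  open RibbonOps R
  open ReflexiveObject RA

  Tr : ∀ {U V X} → (U ⊗₀ X) ⇒ (V ⊗₀ X) → U ⇒ V
  Tr {U} {V} {X} f =
    ru⇐ U ⨾ (id {U} ⊗₁ η X) ⨾ α⇐ U X (X *) ⨾ (f ⊗₁ id {X *}) ⨾ α⇒ V X (X *)
      ⨾ (id {V} ⊗₁ (σ X (X *) ⨾ (id {X *} ⊗₁ θ X) ⨾ ε X)) ⨾ ru⇒ V

  pow : ℕ → Obj
  pow zero = unit
  pow (suc zero) = A
  pow (suc (suc n)) = A ⊗₀ pow (suc n)

  cons : ∀ n → (A ⊗₀ pow n) ⇒ pow (suc n)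
  cons zero = ru⇒ A
  cons (suc n) = id

  uncons : ∀ n → pow (suc n) ⇒ (A ⊗₀ pow n)
  uncons zero = ru⇐ A
  uncons (suc n) = id

  app : (A ⊗₀ A) ⇒ A
  app = (φ⁻¹ ⊗₁ id {A}) ⨾ α⇒ A (A *) A ⨾ (id {A} ⊗₁ ε A) ⨾ ru⇒ A

  lam : A ⇒ (A ⊗₀ A)
  lam = ru⇐ A ⨾ (id {A} ⊗₁ η A) ⨾ (id {A} ⊗₁ (id {A} ⊗₁ θ⁻¹ (A *)))
          ⨾ (id {A} ⊗₁ σ⁻¹ (A *) A) ⨾ α⇐ A (A *) A ⨾ (φ ⊗₁ id {A})

  appₙ : ∀ n → pow (suc n) ⇒ A
  appₙ zero = id
  appₙ (suc n) = (id {A} ⊗₁ uncons n) ⨾ α⇐ A A (pow n) ⨾ (app ⊗₁ id {pow n}) ⨾ cons n ⨾ appₙ n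

  lamₙ : ∀ m → A ⇒ pow (suc m)
  lamₙ zero = id
  lamₙ (suc m) = lamₙ m ⨾ uncons m ⨾ (lam ⊗₁ id {pow m}) ⨾ α⇒ A A (pow m) ⨾ (id {A} ⊗₁ cons m)

  F : ∀ m n → pow m ⇒ pow n → unit ⇒ A
  F m n f = Tr {unit} {A} {A}
    (lu⇒ A ⨾ lamₙ m ⨾ uncons m ⨾ (lam ⊗₁ f) ⨾ α⇒ A A (pow n)
       ⨾ (id {A} ⊗₁ cons n) ⨾ (id {A} ⊗₁ appₙ n))

  Elem : Set ℓ
  Elem = unit ⇒ A

  infixl 20 _·_
  _·_ : Elem → Elem → Elem
  a · b = lu⇐ unit ⨾ (a ⊗₁ b) ⨾ app

  𝐁 : Elem
  𝐁 = F 2 1 app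

  𝐂⁺ : Elem
  𝐂⁺ = F 2 2 (σ A A)

  𝐈 : Elem
  𝐈 = F 0 0 id

  infixr 15 _○_
  _○_ : Elem → Elem → Elem
  a ○ b = 𝐁 · a · b

  _^_ : Elem → ℕ → Elem
  a ^ zero = 𝐈
  a ^ suc n = a ○ (a ^ n)

  _• : Elem → Elem
  a • = 𝐂⁺ · 𝐈 · a

  HasArity : ℕ → ℕ → Elem → Set e
  HasArity m n a = (a •) ○ (𝐁 ^ suc m) ≈ (𝐁 · a) ○ (𝐁 ^ n)

  TraceCondition : Set e
  TraceCondition = Tr {unit} {unit} {A} (id {unit ⊗₀ A}) ≈ id {unit}

  -- F : C|_A → 𝓘_𝒜 (objects A^{⊗m} ↦ m, morphisms f ↦ F f) is an equivalence:
  -- a functor G : 𝓘_𝒜 → C|_A with natural isomorphisms Id ≅ G∘F and F∘G ≅ Id.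
  -- (Morphisms m → n of 𝓘_𝒜 are elements a with HasArity m n a, compared by ≈,
  --  composed by ○, with identities 𝐈.)
  record IsEquivalenceF : Set (o ⊔ ℓ ⊔ e) where
    field
      G₀ : ℕ → ℕ
      G₁ : ∀ m n (a : Elem) → HasArity m n a → pow (G₀ m) ⇒ pow (G₀ n)
      G-resp-≈ : ∀ {m n} {a b : Elem} (p : HasArity m n a) (q : HasArity m n b) →
                 a ≈ b → G₁ m n a p ≈ G₁ m n b q
      G-identity : ∀ n (p : HasArity n n 𝐈) → G₁ n n 𝐈 p ≈ id
      G-homomorphism : ∀ {l m n} {a b : Elem}
                         (p : HasArity l m a) (q : HasArity m n b) (r : HasArity l n (a ○ b)) →
                       G₁ l n (a ○ b) r ≈ G₁ l m a p ⨾ G₁ m n b q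
      unitη    : ∀ m → pow m ⇒ pow (G₀ m)
      unitη⁻¹  : ∀ m → pow (G₀ m) ⇒ pow m
      unitη-isoˡ : ∀ m → unitη m ⨾ unitη⁻¹ m ≈ id
      unitη-isoʳ : ∀ m → unitη⁻¹ m ⨾ unitη m ≈ id
      unitη-natural : ∀ {m n} (f : pow m ⇒ pow n) (p : HasArity m n (F m n f)) →
                      f ⨾ unitη n ≈ unitη m ⨾ G₁ m n (F m n f) p
      counit      : ∀ n → Elem
      counit-arity : ∀ n → HasArity (G₀ n) n (counit n)
      counit⁻¹    : ∀ n → Elem
      counit⁻¹-arity : ∀ n → HasArity n (G₀ n) (counit⁻¹ n)
      counit-isoˡ : ∀ n → counit n ○ counit⁻¹ n ≈ 𝐈
      counit-isoʳ : ∀ n → counit⁻¹ n ○ counit n ≈ 𝐈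
      counit-natural : ∀ {m n} (a : Elem) (p : HasArity m n a) →
                       F (G₀ m) (G₀ n) (G₁ m n a p) ○ counit n ≈ counit m ○ a

  record Conclusion : Set (o ⊔ ℓ ⊔ e) where
    field
      F-arity : ∀ {m n} (f : pow m ⇒ pow n) → HasArity m n (F m n f)
      F-resp-≈ : ∀ {m n} {f g : pow m ⇒ pow n} → f ≈ g → F m n f ≈ F m n g
      F-identity : ∀ m → F m m (id {pow m}) ≈ 𝐈
      F-homomorphism : ∀ {l m n} (f : pow l ⇒ pow m) (g : pow m ⇒ pow n) →
                       F l n (f ⨾ g) ≈ F l m f ○ F m n g
      faithful : ∀ {m n} (f g : pow m ⇒ pow n) → F m n f ≈ F m n g → f ≈ g
      full : ∀ {m n} (a : Elem) → HasArity m n a → Σ (pow m ⇒ pow n) (λ f → F m n f ≈ a)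
      equivalence : IsEquivalenceF

module Submission where

open import Level using (_⊔_)
open import Data.Nat using (ℕ; zero; suc)
open import Data.Product using (Σ; ∃; _,_; proj₁; proj₂)
open import Relation.Binary.Bundles using (Setoid)
import Relation.Binary.Reasoning.Setoid as SetoidReasoning
open import Relation.Binary.Structures using (IsEquivalence)
open import Defs

-- Write D for A*.  Since A ≅ A ⊗ D, morphisms X ⊗ A → A correspond to morphisms X → A by currying,
-- and F f is λ y x₁ … xₘ. y (f (x₁, …, xₘ)) in curried form: the trace in the definition of F
-- turns into iterated currying because a trace can absorb an abstraction followed by an application
-- (abstr-apply; this uses the balance and duality axioms of the twist).  Let g : A ⊗ Aᵐ → A be the
-- uncurried form of an element x.  The arity equation for x says that g commutes with the
-- left action of A ≅ A ⊗ D on itself.  Identifying A with A ⊗ Dⁿ, g becomes A ⊗ Dⁿ ⊗ Aᵐ → A, and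
-- the trace condition provides a section of the evaluation D ⊗ A → I, so that linearity forces
-- this map to be A ⊗ h for a unique h : Dⁿ ⊗ Aᵐ → I.  The transpose of h is the preimage of x.

-- The variable bound by `lam` is an output strand that only a trace feeds back, so the abstractions
-- inside `F` are not currying by themselves. The trace absorbs them because an application can be
-- carried once round its loop: it leaves through the closing cap, transposed, and comes back
-- through the opening cup in front of the abstraction, where the η-rule `coev-apply-fold` removes
-- it. On the way it meets the braid and the twist of the cap.
--
-- The section of D ⊗ A → I is the circle of the trace with its last `ev` cut off. It gives
-- linearity its force: through it the leading factor of A can be written as a left multiple
-- (`K-compose`), and a linear map lets the multiplier pass.
--
-- The other obstacle is bookkeeping. Uncurrying keeps changing the number of tensor factors and the
-- category is not strict. Morphisms are therefore handled as families natural in a spectator object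
-- `Z`, and further arguments are supplied by instantiating `Z`.

module CategoryReasoning {o ℓ e} (C : Category o ℓ e) where
  open Category C

  module _ {X Y : Obj} where
    open IsEquivalence (≈-isEquivalence {X} {Y}) public
      using () renaming (refl to ≈-refl; sym to ≈-sym; trans to ≈-trans)

  hom-setoid : Obj → Obj → Setoid ℓ e
  hom-setoid X Y = record { isEquivalence = ≈-isEquivalence {X} {Y} }

  module HomReasoning {X Y : Obj} where
    open SetoidReasoning (hom-setoid X Y) public

  infixr 5 _⟩⨾⟨_ ⨾⟨_

  _⟩⨾⟨_ : ∀ {X Y Z} {f f′ : X ⇒ Y} {g g′ : Y ⇒ Z} → f ≈ f′ → g ≈ g′ → f ⨾ g ≈ f′ ⨾ g′
  _⟩⨾⟨_ = ⨾-resp-≈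

  ⨾⟨_ : ∀ {X Y Z} {f : X ⇒ Y} {g g′ : Y ⇒ Z} → g ≈ g′ → f ⨾ g ≈ f ⨾ g′
  ⨾⟨ p = ⨾-resp-≈ ≈-refl p

  -- hᵢⱼ rewrites the first i factors of a right-nested composite into j factors.
  private variable V W X Y Z Y′ Z′ : Obj

  h₁₁ : {f g : W ⇒ X} {r : X ⇒ Y} → f ≈ g → f ⨾ r ≈ g ⨾ r
  h₁₁ p = ⨾-resp-≈ p ≈-refl

  h₁₀ : {f : W ⇒ W} {r : W ⇒ X} → f ≈ id → f ⨾ r ≈ r
  h₁₀ p = ≈-trans (h₁₁ p) identityˡ

  h₁₂ : {f : W ⇒ X} {g : W ⇒ Y} {k : Y ⇒ X} {r : X ⇒ V} →
        f ≈ g ⨾ k → f ⨾ r ≈ g ⨾ k ⨾ r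
  h₁₂ p = ≈-trans (h₁₁ p) assoc

  h₂₁ : {f : W ⇒ Y} {g : Y ⇒ X} {k : W ⇒ X} {r : X ⇒ V} →
        f ⨾ g ≈ k → f ⨾ g ⨾ r ≈ k ⨾ r
  h₂₁ p = ≈-sym (h₁₂ (≈-sym p))

  h₂₂ : {f : W ⇒ Y} {g : Y ⇒ X} {h : W ⇒ Y′} {k : Y′ ⇒ X} {r : X ⇒ V} →
        f ⨾ g ≈ h ⨾ k → f ⨾ g ⨾ r ≈ h ⨾ k ⨾ r
  h₂₂ p = ≈-trans (h₂₁ p) assoc

  h₂₀ : {f : W ⇒ Y} {g : Y ⇒ W} {r : W ⇒ X} → f ⨾ g ≈ id → f ⨾ g ⨾ r ≈ r
  h₂₀ p = ≈-trans (h₂₁ p) identityˡ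

  h₃₁ : {f : W ⇒ Y} {g : Y ⇒ Z} {h : Z ⇒ X} {k : W ⇒ X} {r : X ⇒ V} →
        f ⨾ g ⨾ h ≈ k → f ⨾ g ⨾ h ⨾ r ≈ k ⨾ r
  h₃₁ p = ≈-trans (⨾⟨ ≈-sym assoc) (≈-trans (≈-sym assoc) (h₁₁ p))

  h₃₂ : {f : W ⇒ Y} {g : Y ⇒ Z} {h : Z ⇒ X} {k : W ⇒ Y′} {l : Y′ ⇒ X} {r : X ⇒ V} →
        f ⨾ g ⨾ h ≈ k ⨾ l → f ⨾ g ⨾ h ⨾ r ≈ k ⨾ l ⨾ r
  h₃₂ p = ≈-trans (h₃₁ p) assoc

  h₂₃ : {f : W ⇒ Y} {g : Y ⇒ Z} {h : Z ⇒ X} {k : W ⇒ Y′} {l : Y′ ⇒ X} {r : X ⇒ V} →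
        k ⨾ l ≈ f ⨾ g ⨾ h → k ⨾ l ⨾ r ≈ f ⨾ g ⨾ h ⨾ r
  h₂₃ p = ≈-sym (h₃₂ (≈-sym p))

  h₃₃ : {f : W ⇒ Y} {g : Y ⇒ Z} {h : Z ⇒ X}
          {k : W ⇒ Y′} {l : Y′ ⇒ Z′} {m : Z′ ⇒ X} {r : X ⇒ V} →
        f ⨾ g ⨾ h ≈ k ⨾ l ⨾ m → f ⨾ g ⨾ h ⨾ r ≈ k ⨾ l ⨾ m ⨾ r
  h₃₃ p = ≈-trans (h₃₁ p) (≈-trans assoc (⨾⟨ assoc))

  h₁₃ : {f : W ⇒ Y} {g : Y ⇒ Z} {h : Z ⇒ X} {k : W ⇒ X} {r : X ⇒ V} →
        k ≈ f ⨾ g ⨾ h → k ⨾ r ≈ f ⨾ g ⨾ h ⨾ r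
  h₁₃ p = ≈-sym (h₃₁ (≈-sym p))

  square-inverse : ∀ {W X Y Z} {a : W ⇒ X} {a⁻¹ : X ⇒ W} {b : Y ⇒ Z} {b⁻¹ : Z ⇒ Y}
                     {f : W ⇒ Y} {g : X ⇒ Z} →
                   a⁻¹ ⨾ a ≈ id → b ⨾ b⁻¹ ≈ id → a ⨾ g ≈ f ⨾ b → a⁻¹ ⨾ f ≈ g ⨾ b⁻¹
  square-inverse {a = a} {a⁻¹} {b} {b⁻¹} {f} {g} p q r = begin
    a⁻¹ ⨾ f                ≈⟨ ⨾⟨ ≈-sym identityʳ ⟩
    a⁻¹ ⨾ f ⨾ id           ≈⟨ ⨾⟨ ⨾⟨ ≈-sym q ⟩
    a⁻¹ ⨾ f ⨾ b ⨾ b⁻¹      ≈⟨ ⨾⟨ h₂₂ (≈-sym r) ⟩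
    a⁻¹ ⨾ a ⨾ g ⨾ b⁻¹      ≈⟨ h₂₀ p ⟩
    g ⨾ b⁻¹                ∎
    where open HomReasoning

-- Coherence for monoidal categories

module Strictification {o ℓ e} {C : Category o ℓ e} (M : Monoidal C) where
  open Category C
  open Monoidal M
  open CategoryReasoning C
  open HomReasoning

  infixr 11 _▷_
  infixl 11 _◁_

  _▷_ : ∀ X {Y Z} → Y ⇒ Z → (X ⊗₀ Y) ⇒ (X ⊗₀ Z)
  X ▷ f = id {X} ⊗₁ f

  _◁_ : ∀ {Y Z} → Y ⇒ Z → ∀ X → (Y ⊗₀ X) ⇒ (Z ⊗₀ X)
  f ◁ X = f ⊗₁ id {X}

  ▷-resp : ∀ {X Y Z} {f g : Y ⇒ Z} → f ≈ g → X ▷ f ≈ X ▷ g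
  ▷-resp = ⊗-resp-≈ ≈-refl

  ◁-resp : ∀ {X Y Z} {f g : Y ⇒ Z} → f ≈ g → f ◁ X ≈ g ◁ X
  ◁-resp p = ⊗-resp-≈ p ≈-refl

  ▷-⨾ : ∀ {X Y Z W} {f : Y ⇒ Z} {g : Z ⇒ W} → X ▷ (f ⨾ g) ≈ (X ▷ f) ⨾ (X ▷ g)
  ▷-⨾ = ≈-trans (⊗-resp-≈ (≈-sym identityˡ) ≈-refl) ⊗-homomorphism

  ◁-⨾ : ∀ {X Y Z W} {f : Y ⇒ Z} {g : Z ⇒ W} → (f ⨾ g) ◁ X ≈ (f ◁ X) ⨾ (g ◁ X)
  ◁-⨾ = ≈-trans (⊗-resp-≈ ≈-refl (≈-sym identityˡ)) ⊗-homomorphism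

  ▷◁ : ∀ {X Y Z W} {f : X ⇒ Y} {g : Z ⇒ W} → f ⊗₁ g ≈ (X ▷ g) ⨾ (f ◁ W)
  ▷◁ = ≈-trans (⊗-resp-≈ (≈-sym identityˡ) (≈-sym identityʳ)) ⊗-homomorphism

  ◁▷ : ∀ {X Y Z W} {f : X ⇒ Y} {g : Z ⇒ W} → f ⊗₁ g ≈ (f ◁ Z) ⨾ (Y ▷ g)
  ◁▷ = ≈-trans (⊗-resp-≈ (≈-sym identityʳ) (≈-sym identityˡ)) ⊗-homomorphism

  ▷-iso : ∀ {X Y Z} {f : Y ⇒ Z} {g : Z ⇒ Y} → f ⨾ g ≈ id → (X ▷ f) ⨾ (X ▷ g) ≈ id
  ▷-iso p = ≈-trans (≈-sym ▷-⨾) (≈-trans (▷-resp p) ⊗-identity)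

  ◁-iso : ∀ {X Y Z} {f : Y ⇒ Z} {g : Z ⇒ Y} → f ⨾ g ≈ id → (f ◁ X) ⨾ (g ◁ X) ≈ id
  ◁-iso p = ≈-trans (≈-sym ◁-⨾) (≈-trans (◁-resp p) ⊗-identity)

  unit-▷-injective : ∀ {X Y} {f g : X ⇒ Y} → unit ▷ f ≈ unit ▷ g → f ≈ g
  unit-▷-injective {X} {Y} {f} {g} p = begin
    f                               ≈⟨ h₂₀ (lu-isoʳ X) ⟨
    lu⇐ X ⨾ lu⇒ X ⨾ f               ≈⟨ ⨾⟨ lu-natural f ⟨
    lu⇐ X ⨾ (unit ▷ f) ⨾ lu⇒ Y      ≈⟨ ⨾⟨ h₁₁ p ⟩
    lu⇐ X ⨾ (unit ▷ g) ⨾ lu⇒ Y      ≈⟨ ⨾⟨ lu-natural g ⟩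
    lu⇐ X ⨾ lu⇒ X ⨾ g               ≈⟨ h₂₀ (lu-isoʳ X) ⟩
    g                               ∎

  ◁-unit-injective : ∀ {X Y} {f g : X ⇒ Y} → f ◁ unit ≈ g ◁ unit → f ≈ g
  ◁-unit-injective {X} {Y} {f} {g} p = begin
    f                               ≈⟨ h₂₀ (ru-isoʳ X) ⟨
    ru⇐ X ⨾ ru⇒ X ⨾ f               ≈⟨ ⨾⟨ ru-natural f ⟨
    ru⇐ X ⨾ (f ◁ unit) ⨾ ru⇒ Y      ≈⟨ ⨾⟨ h₁₁ p ⟩
    ru⇐ X ⨾ (g ◁ unit) ⨾ ru⇒ Y      ≈⟨ ⨾⟨ ru-natural g ⟩
    ru⇐ X ⨾ ru⇒ X ⨾ g               ≈⟨ h₂₀ (ru-isoʳ X) ⟩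
    g                               ∎

  α-natural-▷ : ∀ {X Y Z W} {f : Z ⇒ W} →
                ((X ⊗₀ Y) ▷ f) ⨾ α⇒ X Y W ≈ α⇒ X Y Z ⨾ (X ▷ Y ▷ f)
  α-natural-▷ {f = f} =
    ≈-trans (h₁₁ (⊗-resp-≈ (≈-sym ⊗-identity) ≈-refl)) (α-natural id id f)

  α-natural-◁ : ∀ {X Y Z W} {f : X ⇒ Y} →
                ((f ◁ Z) ◁ W) ⨾ α⇒ Y Z W ≈ α⇒ X Z W ⨾ (f ◁ (Z ⊗₀ W))
  α-natural-◁ {f = f} = ≈-trans (α-natural f id id) (⨾⟨ ⊗-resp-≈ ≈-refl ⊗-identity)

  -- Kelly's argument, since this law is not an axiom of `Monoidal`: after whiskering with `unit`
  -- and composing with invertible associators, pentagon and triangle bring both sides to the same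
  -- form, and `unit-▷-injective` removes the whiskering.
  lu-⊗ : ∀ X Y → α⇒ unit X Y ⨾ lu⇒ (X ⊗₀ Y) ≈ lu⇒ X ◁ Y
  lu-⊗ X Y = unit-▷-injective (begin
    unit ▷ (α⇒ unit X Y ⨾ lu⇒ (X ⊗₀ Y))
      ≈⟨ h₂₀ (α-isoʳ _ _ _) ⟨
    α⇐ _ _ _ ⨾ α⇒ unit (unit ⊗₀ X) Y ⨾ unit ▷ (α⇒ unit X Y ⨾ lu⇒ (X ⊗₀ Y))
      ≈⟨ ⨾⟨ h₂₀ (◁-iso (α-isoʳ unit unit X)) ⟨
    α⇐ _ _ _ ⨾ (α⇐ unit unit X ◁ Y) ⨾ (α⇒ unit unit X ◁ Y) ⨾ α⇒ unit (unit ⊗₀ X) Y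
      ⨾ unit ▷ (α⇒ unit X Y ⨾ lu⇒ (X ⊗₀ Y))
      ≈⟨ ⨾⟨ ⨾⟨ cancelled ⟩
    α⇐ _ _ _ ⨾ (α⇐ unit unit X ◁ Y) ⨾ (α⇒ unit unit X ◁ Y) ⨾ α⇒ unit (unit ⊗₀ X) Y
      ⨾ unit ▷ (lu⇒ X ◁ Y)
      ≈⟨ ⨾⟨ h₂₀ (◁-iso (α-isoʳ unit unit X)) ⟩
    α⇐ _ _ _ ⨾ α⇒ unit (unit ⊗₀ X) Y ⨾ unit ▷ (lu⇒ X ◁ Y)
      ≈⟨ h₂₀ (α-isoʳ _ _ _) ⟩
    unit ▷ (lu⇒ X ◁ Y) ∎)
    where
    cancelled : (α⇒ unit unit X ◁ Y) ⨾ α⇒ unit (unit ⊗₀ X) Y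
                  ⨾ unit ▷ (α⇒ unit X Y ⨾ lu⇒ (X ⊗₀ Y))
                ≈ (α⇒ unit unit X ◁ Y) ⨾ α⇒ unit (unit ⊗₀ X) Y ⨾ unit ▷ (lu⇒ X ◁ Y)
    cancelled = begin
      (α⇒ unit unit X ◁ Y) ⨾ α⇒ unit (unit ⊗₀ X) Y ⨾ unit ▷ (α⇒ unit X Y ⨾ lu⇒ (X ⊗₀ Y))
        ≈⟨ ⨾⟨ ⨾⟨ ▷-⨾ ⟩
      (α⇒ unit unit X ◁ Y) ⨾ α⇒ unit (unit ⊗₀ X) Y ⨾ (unit ▷ α⇒ unit X Y) ⨾ (unit ▷ lu⇒ (X ⊗₀ Y))
        ≈⟨ h₃₂ (pentagon _ _ _ _) ⟩
      α⇒ (unit ⊗₀ unit) X Y ⨾ α⇒ unit unit (X ⊗₀ Y) ⨾ (unit ▷ lu⇒ (X ⊗₀ Y))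
        ≈⟨ ⨾⟨ triangle _ _ ⟩
      α⇒ (unit ⊗₀ unit) X Y ⨾ (ru⇒ unit ◁ (X ⊗₀ Y))
        ≈⟨ α-natural-◁ ⟨
      ((ru⇒ unit ◁ X) ◁ Y) ⨾ α⇒ unit X Y
        ≈⟨ h₁₁ (◁-resp (triangle _ _)) ⟨
      ((α⇒ unit unit X ⨾ (unit ▷ lu⇒ X)) ◁ Y) ⨾ α⇒ unit X Y
        ≈⟨ h₁₂ ◁-⨾ ⟩
      (α⇒ unit unit X ◁ Y) ⨾ ((unit ▷ lu⇒ X) ◁ Y) ⨾ α⇒ unit X Y
        ≈⟨ ⨾⟨ α-natural _ _ _ ⟩
      (α⇒ unit unit X ◁ Y) ⨾ α⇒ unit (unit ⊗₀ X) Y ⨾ unit ▷ (lu⇒ X ◁ Y) ∎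

  -- Replacing obj by the endofunctor obj ⊗ – makes C strict: composition of endofunctors is
  -- definitionally associative, so α, lu and ru become identities under hat below.
  record Presentation (obj : Obj) (act : Obj → Obj) : Set (o ⊔ ℓ ⊔ e) where
    field
      act₁ : ∀ {X Y} → X ⇒ Y → act X ⇒ act Y
      ι⇒ : ∀ Z → (obj ⊗₀ Z) ⇒ act Z
      ι⇐ : ∀ Z → act Z ⇒ (obj ⊗₀ Z)
      ι-isoˡ : ∀ Z → ι⇒ Z ⨾ ι⇐ Z ≈ id
      ι-isoʳ : ∀ Z → ι⇐ Z ⨾ ι⇒ Z ≈ id
      ι-natural : ∀ {X Y} (f : X ⇒ Y) → (obj ▷ f) ⨾ ι⇒ Y ≈ ι⇒ X ⨾ act₁ f

    ι⇐-natural : ∀ {X Y} (f : X ⇒ Y) → ι⇐ X ⨾ (obj ▷ f) ≈ act₁ f ⨾ ι⇐ Y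
    ι⇐-natural f = square-inverse (ι-isoʳ _) (ι-isoˡ _) (≈-sym (ι-natural f))

    -- `act₁` is conjugate to the functor `obj ▷ –` through `ι`. Congruence and functoriality are
    -- inherited from there, which is why they are not fields.
    act₁-conj : ∀ {X Y} (f : X ⇒ Y) → act₁ f ≈ ι⇐ X ⨾ (obj ▷ f) ⨾ ι⇒ Y
    act₁-conj f = ≈-sym (≈-trans (⨾⟨ ι-natural f) (h₂₀ (ι-isoʳ _)))

    act-resp : ∀ {X Y} {f g : X ⇒ Y} → f ≈ g → act₁ f ≈ act₁ g
    act-resp p =
      ≈-trans (act₁-conj _) (≈-trans (⨾⟨ h₁₁ (▷-resp p)) (≈-sym (act₁-conj _)))

    act-id : ∀ {X} → act₁ (id {X}) ≈ id
    act-id = ≈-trans (act₁-conj _) (≈-trans (⨾⟨ h₁₀ ⊗-identity) (ι-isoʳ _))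

    act-⨾ : ∀ {X Y Z} {f : X ⇒ Y} {g : Y ⇒ Z} → act₁ (f ⨾ g) ≈ act₁ f ⨾ act₁ g
    act-⨾ {f = f} {g} = begin
      act₁ (f ⨾ g)                                ≈⟨ act₁-conj _ ⟩
      ι⇐ _ ⨾ (obj ▷ (f ⨾ g)) ⨾ ι⇒ _              ≈⟨ ⨾⟨ h₁₂ ▷-⨾ ⟩
      ι⇐ _ ⨾ (obj ▷ f) ⨾ (obj ▷ g) ⨾ ι⇒ _        ≈⟨ h₂₂ (ι⇐-natural f) ⟩
      act₁ f ⨾ ι⇐ _ ⨾ (obj ▷ g) ⨾ ι⇒ _           ≈⟨ ⨾⟨ act₁-conj g ⟨
      act₁ f ⨾ act₁ g                             ∎

    act₁₂ : ∀ {X Y Z} {f : X ⇒ Y} {g : Y ⇒ Z} {h : X ⇒ Z} →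
            h ≈ f ⨾ g → act₁ h ≈ act₁ f ⨾ act₁ g
    act₁₂ p = ≈-trans (act-resp p) act-⨾

    act₂₁ : ∀ {X Y Z} {f : X ⇒ Y} {g : Y ⇒ Z} {h : X ⇒ Z} →
            f ⨾ g ≈ h → act₁ f ⨾ act₁ g ≈ act₁ h
    act₂₁ p = ≈-sym (act₁₂ (≈-sym p))

    act₂₂ : ∀ {X Y Y′ Z} {f : X ⇒ Y} {g : Y ⇒ Z} {h : X ⇒ Y′} {k : Y′ ⇒ Z} →
            f ⨾ g ≈ h ⨾ k → act₁ f ⨾ act₁ g ≈ act₁ h ⨾ act₁ k
    act₂₂ p = ≈-trans (act₂₁ p) act-⨾

    act₂₀ : ∀ {X Y} {f : X ⇒ Y} {g : Y ⇒ X} → f ⨾ g ≈ id → act₁ f ⨾ act₁ g ≈ id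
    act₂₀ p = ≈-trans (act₂₁ p) act-id

    act₁₃ : ∀ {X Y Z W} {f : X ⇒ Y} {g : Y ⇒ Z} {h : Z ⇒ W} {k : X ⇒ W} →
            k ≈ f ⨾ g ⨾ h → act₁ k ≈ act₁ f ⨾ act₁ g ⨾ act₁ h
    act₁₃ p = ≈-trans (act₁₂ p) (⨾⟨ act-⨾)

  private variable P Q R S : Obj → Obj

  module _ where
    open Presentation

    atomᵖ : ∀ X → Presentation X (X ⊗₀_)
    atomᵖ X = record
      { act₁ = X ▷_
      ; ι⇒ = λ _ → id ; ι⇐ = λ _ → id
      ; ι-isoˡ = λ _ → identityˡ ; ι-isoʳ = λ _ → identityˡ
      ; ι-natural = λ _ → ≈-trans identityʳ (≈-sym identityˡ) }

    unitᵖ : Presentation unit (λ Z → Z)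
    unitᵖ = record
      { act₁ = λ f → f
      ; ι⇒ = lu⇒ ; ι⇐ = lu⇐ ; ι-isoˡ = lu-isoˡ ; ι-isoʳ = lu-isoʳ ; ι-natural = lu-natural }

    _⊗ᵖ_ : ∀ {X Y} → Presentation X P → Presentation Y Q → Presentation (X ⊗₀ Y) (λ Z → P (Q Z))
    _⊗ᵖ_ {X = X} {Y} s t = record
      { act₁ = λ f → act₁ s (act₁ t f)
      ; ι⇒ = λ Z → α⇒ _ _ Z ⨾ (X ▷ ι⇒ t Z) ⨾ ι⇒ s _
      ; ι⇐ = λ Z → ι⇐ s _ ⨾ (X ▷ ι⇐ t Z) ⨾ α⇐ _ _ Z
      ; ι-isoˡ = λ Z → begin
          (α⇒ _ _ Z ⨾ (X ▷ ι⇒ t Z) ⨾ ι⇒ s _) ⨾ ι⇐ s _ ⨾ (X ▷ ι⇐ t Z) ⨾ α⇐ _ _ Z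
            ≈⟨ ≈-trans assoc (⨾⟨ assoc) ⟩
          α⇒ _ _ Z ⨾ (X ▷ ι⇒ t Z) ⨾ ι⇒ s _ ⨾ ι⇐ s _ ⨾ (X ▷ ι⇐ t Z) ⨾ α⇐ _ _ Z
            ≈⟨ ⨾⟨ ⨾⟨ h₂₀ (ι-isoˡ s _) ⟩
          α⇒ _ _ Z ⨾ (X ▷ ι⇒ t Z) ⨾ (X ▷ ι⇐ t Z) ⨾ α⇐ _ _ Z
            ≈⟨ ⨾⟨ h₂₀ (▷-iso (ι-isoˡ t Z)) ⟩
          α⇒ _ _ Z ⨾ α⇐ _ _ Z
            ≈⟨ α-isoˡ _ _ _ ⟩
          id ∎
      ; ι-isoʳ = λ Z → begin
          (ι⇐ s _ ⨾ (X ▷ ι⇐ t Z) ⨾ α⇐ _ _ Z) ⨾ α⇒ _ _ Z ⨾ (X ▷ ι⇒ t Z) ⨾ ι⇒ s _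
            ≈⟨ ≈-trans assoc (⨾⟨ assoc) ⟩
          ι⇐ s _ ⨾ (X ▷ ι⇐ t Z) ⨾ α⇐ _ _ Z ⨾ α⇒ _ _ Z ⨾ (X ▷ ι⇒ t Z) ⨾ ι⇒ s _
            ≈⟨ ⨾⟨ ⨾⟨ h₂₀ (α-isoʳ _ _ _) ⟩
          ι⇐ s _ ⨾ (X ▷ ι⇐ t Z) ⨾ (X ▷ ι⇒ t Z) ⨾ ι⇒ s _
            ≈⟨ ⨾⟨ h₂₀ (▷-iso (ι-isoʳ t Z)) ⟩
          ι⇐ s _ ⨾ ι⇒ s _
            ≈⟨ ι-isoʳ s _ ⟩
          id ∎
      ; ι-natural = λ {W} {Z} f → begin
          ((X ⊗₀ Y) ▷ f) ⨾ α⇒ _ _ Z ⨾ (X ▷ ι⇒ t Z) ⨾ ι⇒ s _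
            ≈⟨ h₂₂ α-natural-▷ ⟩
          α⇒ _ _ W ⨾ (X ▷ Y ▷ f) ⨾ (X ▷ ι⇒ t Z) ⨾ ι⇒ s _
            ≈⟨ ⨾⟨ h₂₂ (≈-trans (≈-sym ▷-⨾) (≈-trans (▷-resp (ι-natural t f)) ▷-⨾)) ⟩
          α⇒ _ _ W ⨾ (X ▷ ι⇒ t W) ⨾ (X ▷ act₁ t f) ⨾ ι⇒ s _
            ≈⟨ ⨾⟨ ⨾⟨ ι-natural s _ ⟩
          α⇒ _ _ W ⨾ (X ▷ ι⇒ t W) ⨾ ι⇒ s _ ⨾ act₁ s (act₁ t f)
            ≈⟨ ≈-trans assoc (⨾⟨ assoc) ⟨
          (α⇒ _ _ W ⨾ (X ▷ ι⇒ t W) ⨾ ι⇒ s _) ⨾ act₁ s (act₁ t f) ∎ }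

  infixr 10 _⊙_
  -- A shape records a bracketing with its units, which `obj` restores; the index is only the
  -- resulting endofunctor. Different bracketings thus share one index definitionally. `presented`
  -- admits objects such as `pow n`, whose endofunctor is defined by recursion.
  data Shape : (Obj → Obj) → Set (o ⊔ ℓ ⊔ e) where
    ∅ : Shape (λ Z → Z)
    ⟨_⟩ : ∀ X → Shape (X ⊗₀_)
    _⊙_ : Shape P → Shape Q → Shape (λ Z → P (Q Z))
    presented : ∀ {X} → Presentation X P → Shape P

  obj : Shape P → Obj
  obj ∅ = unit
  obj ⟨ X ⟩ = X
  obj (s ⊙ t) = obj s ⊗₀ obj t
  obj (presented {X = X} _) = X

  presentation : (s : Shape P) → Presentation (obj s) P
  presentation ∅ = unitᵖ
  presentation ⟨ X ⟩ = atomᵖ X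
  presentation (s ⊙ t) = presentation s ⊗ᵖ presentation t
  presentation (presented p) = p

  module _ (s : Shape P) where
    open Presentation (presentation s) public

  act : Shape P → Obj → Obj
  act {P} _ = P

  hat : ∀ (s : Shape P) (t : Shape Q) → obj s ⇒ obj t → ∀ Z → act s Z ⇒ act t Z
  hat s t f Z = ι⇐ s Z ⨾ (f ◁ Z) ⨾ ι⇒ t Z

  hat-natural : ∀ (s : Shape P) (t : Shape Q) (f : obj s ⇒ obj t) {X Y} (h : X ⇒ Y) →
                act₁ s h ⨾ hat s t f Y ≈ hat s t f X ⨾ act₁ t h
  hat-natural s t f {X} {Y} h = begin
    act₁ s h ⨾ ι⇐ s Y ⨾ (f ◁ Y) ⨾ ι⇒ t Y       ≈⟨ h₂₂ (ι⇐-natural s h) ⟨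
    ι⇐ s X ⨾ (obj s ▷ h) ⨾ (f ◁ Y) ⨾ ι⇒ t Y    ≈⟨ ⨾⟨ h₂₂ (≈-trans (≈-sym ▷◁) ◁▷) ⟩
    ι⇐ s X ⨾ (f ◁ X) ⨾ (obj t ▷ h) ⨾ ι⇒ t Y    ≈⟨ ⨾⟨ ⨾⟨ ι-natural t h ⟩
    ι⇐ s X ⨾ (f ◁ X) ⨾ ι⇒ t X ⨾ act₁ t h       ≈⟨ ≈-trans assoc (⨾⟨ assoc) ⟨
    (ι⇐ s X ⨾ (f ◁ X) ⨾ ι⇒ t X) ⨾ act₁ t h     ∎

  -- The component at `unit` determines the morphism because `– ⊗ unit` is faithful, so equations of
  -- morphisms may be checked on the strict side and at one object.
  hat-injective : ∀ (s : Shape P) (t : Shape Q) {f g : obj s ⇒ obj t} → hat s t f unit ≈ hat s t g unit → f ≈ g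
  hat-injective s t {f} {g} p = ◁-unit-injective (begin
    f ◁ unit                                   ≈⟨ unhat f ⟨
    ι⇒ s unit ⨾ hat s t f unit ⨾ ι⇐ t unit     ≈⟨ ⨾⟨ h₁₁ p ⟩
    ι⇒ s unit ⨾ hat s t g unit ⨾ ι⇐ t unit     ≈⟨ unhat g ⟩
    g ◁ unit                                   ∎)
    where
    unhat : ∀ f → ι⇒ s unit ⨾ hat s t f unit ⨾ ι⇐ t unit ≈ f ◁ unit
    unhat f = begin
      ι⇒ s unit ⨾ (ι⇐ s unit ⨾ (f ◁ unit) ⨾ ι⇒ t unit) ⨾ ι⇐ t unit
        ≈⟨ ⨾⟨ ≈-trans assoc (⨾⟨ assoc) ⟩
      ι⇒ s unit ⨾ ι⇐ s unit ⨾ (f ◁ unit) ⨾ ι⇒ t unit ⨾ ι⇐ t unit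
        ≈⟨ h₂₀ (ι-isoˡ s _) ⟩
      (f ◁ unit) ⨾ ι⇒ t unit ⨾ ι⇐ t unit
        ≈⟨ ≈-trans (⨾⟨ ι-isoˡ t _) identityʳ ⟩
      f ◁ unit ∎

  unhat : ∀ (s : Shape P) (t : Shape Q) → act s unit ⇒ act t unit → obj s ⇒ obj t
  unhat s t u = ru⇐ _ ⨾ ι⇒ s unit ⨾ u ⨾ ι⇐ t unit ⨾ ru⇒ _

  hat-unhat : ∀ (s : Shape P) (t : Shape Q) (u : act s unit ⇒ act t unit) → hat s t (unhat s t u) unit ≈ u
  hat-unhat s t u = begin
    ι⇐ s unit ⨾ (unhat s t u ◁ unit) ⨾ ι⇒ t unit              ≈⟨ ⨾⟨ h₁₁ conj ⟩
    ι⇐ s unit ⨾ (ι⇒ s unit ⨾ u ⨾ ι⇐ t unit) ⨾ ι⇒ t unit       ≈⟨ ⨾⟨ ≈-trans assoc (⨾⟨ assoc) ⟩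
    ι⇐ s unit ⨾ ι⇒ s unit ⨾ u ⨾ ι⇐ t unit ⨾ ι⇒ t unit         ≈⟨ h₂₀ (ι-isoʳ s _) ⟩
    u ⨾ ι⇐ t unit ⨾ ι⇒ t unit                                 ≈⟨ ≈-trans (⨾⟨ ι-isoʳ t _) identityʳ ⟩
    u                                                         ∎
    where
    conj : unhat s t u ◁ unit ≈ ι⇒ s unit ⨾ u ⨾ ι⇐ t unit
    conj = begin
      unhat s t u ◁ unit
        ≈⟨ ≈-trans (⨾⟨ ru-isoˡ _) identityʳ ⟨
      (unhat s t u ◁ unit) ⨾ ru⇒ _ ⨾ ru⇐ _
        ≈⟨ h₂₂ (ru-natural _) ⟩
      ru⇒ _ ⨾ (ru⇐ _ ⨾ ι⇒ s unit ⨾ u ⨾ ι⇐ t unit ⨾ ru⇒ _) ⨾ ru⇐ _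
        ≈⟨ ⨾⟨ ≈-trans assoc (⨾⟨ ≈-trans assoc (⨾⟨ ≈-trans assoc (⨾⟨ assoc))) ⟩
      ru⇒ _ ⨾ ru⇐ _ ⨾ ι⇒ s unit ⨾ u ⨾ ι⇐ t unit ⨾ ru⇒ _ ⨾ ru⇐ _
        ≈⟨ h₂₀ (ru-isoˡ _) ⟩
      ι⇒ s unit ⨾ u ⨾ ι⇐ t unit ⨾ ru⇒ _ ⨾ ru⇐ _
        ≈⟨ ⨾⟨ ⨾⟨ ≈-trans (⨾⟨ ru-isoˡ _) identityʳ ⟩
      ι⇒ s unit ⨾ u ⨾ ι⇐ t unit ∎

  -- `u` is `f` with the coherence isomorphisms erased. Wrapping the equations in a record keeps
  -- `s`, `t` and `f` visible to unification; they could not be recovered from the unfolded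
  -- composites.
  record Denotes (s : Shape P) (t : Shape Q) (f : obj s ⇒ obj t) (u : ∀ Z → P Z ⇒ Q Z) :
      Set (o ⊔ e) where
    constructor denotes
    field at : ∀ Z → hat s t f Z ≈ u Z
  open Denotes public


  module _ {s : Shape P} {t : Shape Q} where
    ↝-refl : ∀ {f} → Denotes s t f (hat s t f)
    ↝-refl = denotes λ _ → ≈-refl

    ↝-resp : ∀ {f g u} → f ≈ g → Denotes s t g u → Denotes s t f u
    ↝-resp p d = denotes λ Z → ≈-trans (⨾⟨ h₁₁ (◁-resp p)) (at d Z)

    infixl 4 _↝≈_
    _↝≈_ : ∀ {f u v} → Denotes s t f u → (∀ Z → u Z ≈ v Z) → Denotes s t f v
    d ↝≈ p = denotes λ Z → ≈-trans (at d Z) (p Z)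

    -- The route by which every axiom reaches the strict side: both sides are denoted factor by
    -- factor, and the equation in the category becomes an equation of families without associators
    -- and unitors.
    ↝-unique : ∀ {f g u v} → Denotes s t f u → Denotes s t g v → f ≈ g → ∀ Z → u Z ≈ v Z
    ↝-unique d d′ p Z = ≈-trans (≈-sym (at d Z)) (at (↝-resp p d′) Z)

    ↝-natural : ∀ {f u} → Denotes s t f u → ∀ {X Y} (h : X ⇒ Y) →
                act₁ s h ⨾ u Y ≈ u X ⨾ act₁ t h
    ↝-natural d h =
      ≈-trans (⨾⟨ ≈-sym (at d _)) (≈-trans (hat-natural s t _ h) (h₁₁ (at d _)))

  structural : {s t : Shape P} {f : obj s ⇒ obj t} →
               (∀ Z → (f ◁ Z) ⨾ ι⇒ t Z ≈ ι⇒ s Z) → Denotes s t f (λ _ → id)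
  structural {s = s} p = denotes λ Z → ≈-trans (⨾⟨ p Z) (ι-isoʳ s Z)

  ↝-id : ∀ (s : Shape P) → Denotes s s id (λ _ → id)
  ↝-id s = structural λ Z → h₁₀ ⊗-identity

  infixr 5 _⨾↝_ _ˢ⨾↝_ _⨾↝ˢ_
  infixr 6 _⊗↝_

  _⨾↝_ : ∀ {s : Shape P} {t : Shape Q} {w : Shape R} {f g u v} →
         Denotes s t f u → Denotes t w g v → Denotes s w (f ⨾ g) (λ Z → u Z ⨾ v Z)
  _⨾↝_ {s = s} {t} {w} {f} {g} d d′ = denotes λ Z → begin
    ι⇐ s Z ⨾ ((f ⨾ g) ◁ Z) ⨾ ι⇒ w Z
      ≈⟨ ⨾⟨ h₁₂ ◁-⨾ ⟩
    ι⇐ s Z ⨾ (f ◁ Z) ⨾ (g ◁ Z) ⨾ ι⇒ w Z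
      ≈⟨ ⨾⟨ ⨾⟨ h₂₀ (ι-isoˡ t Z) ⟨
    ι⇐ s Z ⨾ (f ◁ Z) ⨾ ι⇒ t Z ⨾ ι⇐ t Z ⨾ (g ◁ Z) ⨾ ι⇒ w Z
      ≈⟨ ≈-trans assoc (⨾⟨ assoc) ⟨
    hat s t f Z ⨾ hat t w g Z
      ≈⟨ at d Z ⟩⨾⟨ at d′ Z ⟩
    _ ∎

  _ˢ⨾↝_ : ∀ {s t : Shape P} {w : Shape Q} {f g v} →
          Denotes s t f (λ _ → id) → Denotes t w g v → Denotes s w (f ⨾ g) v
  d ˢ⨾↝ d′ = (d ⨾↝ d′) ↝≈ λ _ → identityˡ

  _⨾↝ˢ_ : ∀ {s : Shape P} {t w : Shape Q} {f g u} →
          Denotes s t f u → Denotes t w g (λ _ → id) → Denotes s w (f ⨾ g) u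
  d ⨾↝ˢ d′ = (d ⨾↝ d′) ↝≈ λ _ → identityʳ

  _⊗↝_ : ∀ {P′ Q′} {s : Shape P} {s′ : Shape P′} {t : Shape Q} {t′ : Shape Q′} {f g u v} →
         Denotes s s′ f u → Denotes t t′ g v →
         Denotes (s ⊙ t) (s′ ⊙ t′) (f ⊗₁ g) (λ Z → act₁ s (v Z) ⨾ u (Q′ Z))
  _⊗↝_ {Q′ = Q′} {s = s} {s′} {t} {t′} {f} {g} {u} {v} d d′ = denotes λ Z → begin
    (ι⇐ s _ ⨾ (_ ▷ ι⇐ t Z) ⨾ α⇐ _ _ Z) ⨾ ((f ⊗₁ g) ◁ Z) ⨾ α⇒ _ _ Z ⨾ (_ ▷ ι⇒ t′ Z) ⨾ ι⇒ s′ _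
      ≈⟨ ≈-trans assoc (⨾⟨ assoc) ⟩
    ι⇐ s _ ⨾ (_ ▷ ι⇐ t Z) ⨾ α⇐ _ _ Z ⨾ ((f ⊗₁ g) ◁ Z) ⨾ α⇒ _ _ Z ⨾ (_ ▷ ι⇒ t′ Z) ⨾ ι⇒ s′ _
      ≈⟨ ⨾⟨ ⨾⟨ ⨾⟨ h₂₂ (α-natural f g id) ⟩
    ι⇐ s _ ⨾ (_ ▷ ι⇐ t Z) ⨾ α⇐ _ _ Z ⨾ α⇒ _ _ Z ⨾ (f ⊗₁ (g ◁ Z)) ⨾ (_ ▷ ι⇒ t′ Z) ⨾ ι⇒ s′ _
      ≈⟨ ⨾⟨ ⨾⟨ h₂₀ (α-isoʳ _ _ _) ⟩
    ι⇐ s _ ⨾ (_ ▷ ι⇐ t Z) ⨾ (f ⊗₁ (g ◁ Z)) ⨾ (_ ▷ ι⇒ t′ Z) ⨾ ι⇒ s′ _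
      ≈⟨ ⨾⟨ h₃₁ whiskered ⟩
    ι⇐ s _ ⨾ (f ⊗₁ hat t t′ g Z) ⨾ ι⇒ s′ _
      ≈⟨ ⨾⟨ h₁₂ ▷◁ ⟩
    ι⇐ s _ ⨾ (_ ▷ hat t t′ g Z) ⨾ (f ◁ _) ⨾ ι⇒ s′ _
      ≈⟨ h₂₂ (ι⇐-natural s _) ⟩
    act₁ s (hat t t′ g Z) ⨾ hat s s′ f _
      ≈⟨ act-resp s (at d′ Z) ⟩⨾⟨ at d _ ⟩
    act₁ s (v Z) ⨾ u (Q′ Z) ∎
    where
    whiskered : ∀ {U V X Y Z W} {p : X ⇒ Y} {q : Y ⇒ Z} {r : Z ⇒ W} {k : U ⇒ V} →
                (_ ▷ p) ⨾ (k ⊗₁ q) ⨾ (_ ▷ r) ≈ k ⊗₁ (p ⨾ q ⨾ r)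
    whiskered = begin
      _ ≈⟨ ⨾⟨ ⊗-homomorphism ⟨
      _ ≈⟨ ⊗-homomorphism ⟨
      _ ≈⟨ ⊗-resp-≈ (≈-trans identityˡ identityʳ) ≈-refl ⟩
      _ ∎

  ↝-▷ : ∀ {P′} (s : Shape P′) {t : Shape P} {t′ : Shape Q} {g v} → Denotes t t′ g v →
        Denotes (s ⊙ t) (s ⊙ t′) (id ⊗₁ g) (λ Z → act₁ s (v Z))
  ↝-▷ s d = (↝-id s ⊗↝ d) ↝≈ λ _ → identityʳ

  ↝-◁ : ∀ {s : Shape P} {s′ : Shape Q} (t : Shape R) {f u} → Denotes s s′ f u →
        Denotes (s ⊙ t) (s′ ⊙ t) (f ⊗₁ id) (λ Z → u (act t Z))
  ↝-◁ {s = s} t d = (d ⊗↝ ↝-id t) ↝≈ λ _ → h₁₀ (act-id s)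

  ↝-▷ˢ : ∀ (s : Shape P) {t t′ : Shape Q} {g} → Denotes t t′ g (λ _ → id) →
         Denotes (s ⊙ t) (s ⊙ t′) (id ⊗₁ g) (λ _ → id)
  ↝-▷ˢ s d = ↝-▷ s d ↝≈ λ _ → act-id s

  ↝-inverseˢ : ∀ {s t : Shape P} {f g} → g ⨾ f ≈ id → Denotes s t f (λ _ → id) →
               Denotes t s g (λ _ → id)
  ↝-inverseˢ {s = s} {t} {f} {g} p d = structural λ Z → begin
    (g ◁ Z) ⨾ ι⇒ s Z                                ≈⟨ ⨾⟨ ι≈ Z ⟩
    (g ◁ Z) ⨾ (f ◁ Z) ⨾ ι⇒ t Z                      ≈⟨ h₂₀ (◁-iso p) ⟩
    ι⇒ t Z                                          ∎
    where
    ι≈ : ∀ Z → ι⇒ s Z ≈ (f ◁ Z) ⨾ ι⇒ t Z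
    ι≈ Z = begin
      ι⇒ s Z                                ≈⟨ identityʳ ⟨
      ι⇒ s Z ⨾ id                           ≈⟨ ⨾⟨ at d Z ⟨
      ι⇒ s Z ⨾ ι⇐ s Z ⨾ (f ◁ Z) ⨾ ι⇒ t Z    ≈⟨ h₂₀ (ι-isoˡ s Z) ⟩
      (f ◁ Z) ⨾ ι⇒ t Z                      ∎

  -- Both bracketings have the same endofunctor, and that the associator becomes its identity is the
  -- pentagon. For the unitors below, `lu-⊗` and the triangle do the same.
  α↝ : ∀ (s : Shape P) (t : Shape Q) (w : Shape R) →
       Denotes ((s ⊙ t) ⊙ w) (s ⊙ (t ⊙ w)) (α⇒ (obj s) (obj t) (obj w)) (λ _ → id)
  α↝ s t w = structural λ Z → ≈-sym (begin
    α⇒ _ _ Z ⨾ (_ ▷ ι⇒ w Z) ⨾ α⇒ _ _ _ ⨾ (_ ▷ ι⇒ t _) ⨾ ι⇒ s _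
      ≈⟨ ⨾⟨ h₂₂ α-natural-▷ ⟩
    α⇒ _ _ Z ⨾ α⇒ _ _ _ ⨾ (_ ▷ _ ▷ ι⇒ w Z) ⨾ (_ ▷ ι⇒ t _) ⨾ ι⇒ s _
      ≈⟨ h₂₃ (≈-sym (pentagon _ _ _ _)) ⟩
    (α⇒ _ _ _ ◁ Z) ⨾ α⇒ _ _ Z ⨾ (_ ▷ α⇒ _ _ Z) ⨾ (_ ▷ _ ▷ ι⇒ w Z) ⨾ (_ ▷ ι⇒ t _) ⨾ ι⇒ s _
      ≈⟨ ⨾⟨ ⨾⟨ h₃₁ (≈-sym (≈-trans ▷-⨾ (⨾⟨ ▷-⨾))) ⟩
    (α⇒ _ _ _ ◁ Z) ⨾ α⇒ _ _ Z ⨾ (_ ▷ (α⇒ _ _ Z ⨾ (_ ▷ ι⇒ w Z) ⨾ ι⇒ t _)) ⨾ ι⇒ s _ ∎)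

  α⁻¹↝ : ∀ (s : Shape P) (t : Shape Q) (w : Shape R) →
         Denotes (s ⊙ (t ⊙ w)) ((s ⊙ t) ⊙ w) (α⇐ (obj s) (obj t) (obj w)) (λ _ → id)
  α⁻¹↝ s t w = ↝-inverseˢ (α-isoʳ _ _ _) (α↝ s t w)

  lu↝ : ∀ (s : Shape P) → Denotes (∅ ⊙ s) s (lu⇒ (obj s)) (λ _ → id)
  lu↝ s = structural λ Z → ≈-sym (begin
    α⇒ _ _ Z ⨾ (unit ▷ ι⇒ s Z) ⨾ lu⇒ _   ≈⟨ ⨾⟨ lu-natural _ ⟩
    α⇒ _ _ Z ⨾ lu⇒ _ ⨾ ι⇒ s Z            ≈⟨ h₂₁ (lu-⊗ _ _) ⟩
    (lu⇒ _ ◁ Z) ⨾ ι⇒ s Z                 ∎)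

  lu⁻¹↝ : ∀ (s : Shape P) → Denotes s (∅ ⊙ s) (lu⇐ (obj s)) (λ _ → id)
  lu⁻¹↝ s = ↝-inverseˢ (lu-isoʳ _) (lu↝ s)

  ru↝ : ∀ (s : Shape P) → Denotes (s ⊙ ∅) s (ru⇒ (obj s)) (λ _ → id)
  ru↝ s = structural λ Z → ≈-sym (h₂₁ (triangle _ _))

  ru⁻¹↝ : ∀ (s : Shape P) → Denotes s (s ⊙ ∅) (ru⇐ (obj s)) (λ _ → id)
  ru⁻¹↝ s = ↝-inverseˢ (ru-isoʳ _) (ru↝ s)

  module _ {X : Obj} where
    ▷₂₁ : ∀ {W Y Z} {f : W ⇒ Y} {g : Y ⇒ Z} {h : W ⇒ Z} → f ⨾ g ≈ h → X ▷ f ⨾ X ▷ g ≈ X ▷ h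
    ▷₂₁ = act₂₁ ⟨ X ⟩

    ▷₂₂ : ∀ {W Y Y′ Z} {f : W ⇒ Y} {g : Y ⇒ Z} {h : W ⇒ Y′} {k : Y′ ⇒ Z} →
          f ⨾ g ≈ h ⨾ k → X ▷ f ⨾ X ▷ g ≈ X ▷ h ⨾ X ▷ k
    ▷₂₂ = act₂₂ ⟨ X ⟩

    ▷₂₀ : ∀ {W Y} {f : W ⇒ Y} {g : Y ⇒ W} → f ⨾ g ≈ id → X ▷ f ⨾ X ▷ g ≈ id
    ▷₂₀ = act₂₀ ⟨ X ⟩

    ▷₁₃ : ∀ {W Y Y′ Z} {f : W ⇒ Y} {g : Y ⇒ Y′} {h : Y′ ⇒ Z} →
          X ▷ (f ⨾ g ⨾ h) ≈ X ▷ f ⨾ X ▷ g ⨾ X ▷ h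
    ▷₁₃ = act₁₃ ⟨ X ⟩ ≈-refl

-- Braid and twist as strict families

module Braiding {o ℓ e} (R : RibbonCategory o ℓ e) where
  open RibbonOps R hiding (twist)
  open CategoryReasoning category
  open HomReasoning
  open Strictification monoidal

  private variable P Q S : Obj → Obj

  module _ (s : Shape P) (t : Shape Q) where
    braid : ∀ Z → P (Q Z) ⇒ Q (P Z)
    braid = hat (s ⊙ t) (t ⊙ s) (σ (obj s) (obj t))

    unbraid : ∀ Z → Q (P Z) ⇒ P (Q Z)
    unbraid = hat (t ⊙ s) (s ⊙ t) (σ⁻¹ (obj s) (obj t))

    σ↝ : Denotes (s ⊙ t) (t ⊙ s) (σ (obj s) (obj t)) braid
    σ↝ = ↝-refl

    σ⁻¹↝ : Denotes (t ⊙ s) (s ⊙ t) (σ⁻¹ (obj s) (obj t)) unbraid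
    σ⁻¹↝ = ↝-refl

    braid-isoˡ : ∀ Z → braid Z ⨾ unbraid Z ≈ id
    braid-isoˡ = ↝-unique (σ↝ ⨾↝ σ⁻¹↝) (↝-id (s ⊙ t)) (σ-isoˡ _ _)

    braid-isoʳ : ∀ Z → unbraid Z ⨾ braid Z ≈ id
    braid-isoʳ = ↝-unique (σ⁻¹↝ ⨾↝ σ↝) (↝-id (t ⊙ s)) (σ-isoʳ _ _)

  module _ {s : Shape P} {t : Shape Q} {f : obj s ⇒ obj t} {u : ∀ Z → P Z ⇒ Q Z}
           (d : Denotes s t f u) (w : Shape S) where
    braid-slideˡ : ∀ Z → u (S Z) ⨾ braid t w Z ≈ braid s w Z ⨾ act₁ w (u Z)
    braid-slideˡ = ↝-unique (↝-◁ w d ⨾↝ σ↝ t w) (σ↝ s w ⨾↝ ↝-▷ w d) (σ-natural f id)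

    braid-slideʳ : ∀ Z → act₁ w (u Z) ⨾ braid w t Z ≈ braid w s Z ⨾ u (S Z)
    braid-slideʳ = ↝-unique (↝-▷ w d ⨾↝ σ↝ w t) (σ↝ w s ⨾↝ ↝-◁ w d) (σ-natural id f)

  module _ (s : Shape P) (t : Shape Q) (w : Shape S) where
    braid-⊙ˡ : ∀ Z → braid (s ⊙ t) w Z ≈ act₁ s (braid t w Z) ⨾ braid s w (Q Z)
    braid-⊙ˡ = ↝-unique
      (α⁻¹↝ s t w ˢ⨾↝ σ↝ (s ⊙ t) w ⨾↝ˢ α⁻¹↝ w s t)
      (↝-▷ s (σ↝ t w) ⨾↝ α⁻¹↝ s w t ˢ⨾↝ ↝-◁ t (σ↝ s w))
      (hexagon₂ _ _ _)

    braid-⊙ʳ : ∀ Z → braid s (t ⊙ w) Z ≈ braid s t (S Z) ⨾ act₁ t (braid s w Z)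
    braid-⊙ʳ = ↝-unique
      (α↝ s t w ˢ⨾↝ σ↝ s (t ⊙ w) ⨾↝ˢ α↝ t w s)
      (↝-◁ w (σ↝ s t) ⨾↝ α↝ t s w ˢ⨾↝ ↝-▷ t (σ↝ s w))
      (hexagon₁ _ _ _)

  -- Used for the unit laws of braid and twist, which are not axioms. Naturality along `lu⇒ unit`
  -- combined with a hexagon, or with the balance axiom, makes each of these isomorphisms
  -- idempotent.
  idempotent-iso : ∀ {X} {f g : X ⇒ X} → f ⨾ g ≈ id → f ≈ f ⨾ f → f ≈ id
  idempotent-iso {f = f} {g} iso idem = begin
    f              ≈⟨ identityʳ ⟨
    f ⨾ id         ≈⟨ ⨾⟨ iso ⟨
    f ⨾ f ⨾ g      ≈⟨ h₂₁ (≈-sym idem) ⟩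
    f ⨾ g          ≈⟨ iso ⟩
    id             ∎

  module _ (s : Shape P) where
    braid-∅ˡ : ∀ Z → braid ∅ s Z ≈ id
    braid-∅ˡ Z = idempotent-iso (braid-isoˡ ∅ s Z) (begin
      braid ∅ s Z                    ≈⟨ identityˡ ⟨
      id ⨾ braid ∅ s Z               ≈⟨ braid-slideˡ (lu↝ ∅) s Z ⟩
      braid (∅ ⊙ ∅) s Z ⨾ act₁ s id  ≈⟨ ≈-trans (⨾⟨ act-id s) identityʳ ⟩
      braid (∅ ⊙ ∅) s Z              ≈⟨ braid-⊙ˡ ∅ ∅ s Z ⟩
      braid ∅ s Z ⨾ braid ∅ s Z      ∎)

    braid-∅ʳ : ∀ Z → braid s ∅ Z ≈ id
    braid-∅ʳ Z = idempotent-iso (braid-isoˡ s ∅ Z) (begin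
      braid s ∅ Z                      ≈⟨ h₁₀ (act-id s) ⟨
      act₁ s id ⨾ braid s ∅ Z          ≈⟨ braid-slideʳ (lu↝ ∅) s Z ⟩
      braid s (∅ ⊙ ∅) Z ⨾ id           ≈⟨ identityʳ ⟩
      braid s (∅ ⊙ ∅) Z                ≈⟨ braid-⊙ʳ s ∅ ∅ Z ⟩
      braid s ∅ Z ⨾ braid s ∅ Z        ∎)

    twist untwist : ∀ Z → P Z ⇒ P Z
    twist = hat s s (θ (obj s))
    untwist = hat s s (θ⁻¹ (obj s))

    θ↝ : Denotes s s (θ (obj s)) twist
    θ↝ = ↝-refl

    θ⁻¹↝ : Denotes s s (θ⁻¹ (obj s)) untwist
    θ⁻¹↝ = ↝-refl

    twist-isoˡ : ∀ Z → twist Z ⨾ untwist Z ≈ id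
    twist-isoˡ = ↝-unique (θ↝ ⨾↝ θ⁻¹↝) (↝-id s) (θ-isoˡ _)

  twist-slide : ∀ {s : Shape P} {t : Shape Q} {f u} → Denotes s t f u →
                ∀ Z → u Z ⨾ twist t Z ≈ twist s Z ⨾ u Z
  twist-slide {s = s} {t} {f} d = ↝-unique (d ⨾↝ θ↝ t) (θ↝ s ⨾↝ d) (θ-natural f)

  twist-⊙ : ∀ (s : Shape P) (t : Shape Q) Z →
            twist (s ⊙ t) Z ≈ braid s t Z ⨾ act₁ t (twist s Z) ⨾ twist t (P Z) ⨾ braid t s Z
  twist-⊙ s t Z = ≈-trans
    (↝-unique (θ↝ (s ⊙ t)) (σ↝ s t ⨾↝ (θ↝ t ⊗↝ θ↝ s) ⨾↝ σ↝ t s) (θ-balance _ _) Z)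
    (⨾⟨ assoc)

  twist-∅ : ∀ Z → twist ∅ Z ≈ id
  twist-∅ Z = idempotent-iso (twist-isoˡ ∅ Z) (begin
    twist ∅ Z                                           ≈⟨ identityˡ ⟨
    id ⨾ twist ∅ Z                                      ≈⟨ twist-slide (lu↝ ∅) Z ⟩
    twist (∅ ⊙ ∅) Z ⨾ id                                ≈⟨ identityʳ ⟩
    twist (∅ ⊙ ∅) Z                                     ≈⟨ twist-⊙ ∅ ∅ Z ⟩
    braid ∅ ∅ Z ⨾ twist ∅ Z ⨾ twist ∅ Z ⨾ braid ∅ ∅ Z   ≈⟨ h₁₀ (braid-∅ˡ ∅ Z) ⟩
    twist ∅ Z ⨾ twist ∅ Z ⨾ braid ∅ ∅ Z                 ≈⟨ ⨾⟨ ≈-trans (⨾⟨ braid-∅ˡ ∅ Z) identityʳ ⟩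
    twist ∅ Z ⨾ twist ∅ Z                               ∎)

-- `D` as a dual of `A` on either side

module Duality {o ℓ e} (R : RibbonCategory o ℓ e) (A : RibbonOps.Obj R) where
  open RibbonOps R hiding (twist)
  open CategoryReasoning category
  open HomReasoning
  open Strictification monoidal
  open Braiding R

  D : Obj
  D = A *

  a : Shape (A ⊗₀_)
  a = ⟨ A ⟩

  d : Shape (D ⊗₀_)
  d = ⟨ D ⟩

  coev : ∀ Z → Z ⇒ (A ⊗₀ D ⊗₀ Z)
  coev = hat ∅ (a ⊙ d) (η A)

  ev : ∀ Z → (D ⊗₀ A ⊗₀ Z) ⇒ Z
  ev = hat (d ⊙ a) ∅ (ε A)

  η↝ : Denotes ∅ (a ⊙ d) (η A) coev
  η↝ = ↝-refl

  ε↝ : Denotes (d ⊙ a) ∅ (ε A) ev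
  ε↝ = ↝-refl

  coev-natural : ∀ {X Y} (f : X ⇒ Y) → f ⨾ coev Y ≈ coev X ⨾ A ▷ D ▷ f
  coev-natural = ↝-natural η↝

  ev-natural : ∀ {X Y} (f : X ⇒ Y) → D ▷ A ▷ f ⨾ ev Y ≈ ev X ⨾ f
  ev-natural = ↝-natural ε↝

  coev-ev : ∀ Z → coev (A ⊗₀ Z) ⨾ A ▷ ev Z ≈ id
  coev-ev = ↝-unique
    (lu⁻¹↝ a ˢ⨾↝ ↝-◁ a η↝ ⨾↝ α↝ a d a ˢ⨾↝ ↝-▷ a ε↝ ⨾↝ˢ ru↝ a) (↝-id a) (snake₁ A)

  ev-coev : ∀ Z → D ▷ coev Z ⨾ ev (D ⊗₀ Z) ≈ id
  ev-coev = ↝-unique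
    (ru⁻¹↝ d ˢ⨾↝ ↝-▷ d η↝ ⨾↝ α⁻¹↝ d a d ˢ⨾↝ ↝-◁ d ε↝ ⨾↝ˢ lu↝ d) (↝-id d) (snake₂ A)

  twist-dual : ∀ Z → D ▷ coev Z ⨾ D ▷ twist a (D ⊗₀ Z) ⨾ ev (D ⊗₀ Z) ≈ twist d Z
  twist-dual = ↝-unique
    (ru⁻¹↝ d ˢ⨾↝ ↝-▷ d η↝ ⨾↝ α⁻¹↝ d a d ˢ⨾↝ ↝-◁ d (↝-▷ d (θ↝ a)) ⨾↝ ↝-◁ d ε↝ ⨾↝ˢ lu↝ d)
    (θ↝ d) (θ-dual A)

  -- With A on the other side, D is dual to A by means of rcoev and rev.
  rη : unit ⇒ (D ⊗₀ A)
  rη = η A ⨾ (id ⊗₁ θ⁻¹ D) ⨾ σ⁻¹ D A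

  rcoev : ∀ Z → Z ⇒ (D ⊗₀ A ⊗₀ Z)
  rcoev Z = coev Z ⨾ A ▷ untwist d Z ⨾ unbraid d a Z

  rη↝ : Denotes ∅ (d ⊙ a) rη rcoev
  rη↝ = η↝ ⨾↝ ↝-▷ a (θ⁻¹↝ d) ⨾↝ σ⁻¹↝ d a

  -- This is the cap that closes the loop in `Tr`, just as `rη` is the cup inside `lam`; an
  -- abstraction can therefore meet the trace in a snake equation.
  rε : (A ⊗₀ D) ⇒ unit
  rε = σ A D ⨾ (id ⊗₁ θ A) ⨾ ε A

  rev : ∀ Z → (A ⊗₀ D ⊗₀ Z) ⇒ Z
  rev Z = braid a d Z ⨾ D ▷ twist a Z ⨾ ev Z

  rε↝ : Denotes (a ⊙ d) ∅ rε rev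
  rε↝ = σ↝ a d ⨾↝ ↝-▷ d (θ↝ a) ⨾↝ ε↝

  module _ {P : Obj → Obj} (s : Shape P) (Z : Obj) where
    coev-slide : coev (P Z) ⨾ A ▷ braid d s Z ⨾ braid a s (D ⊗₀ Z) ≈ act₁ s (coev Z)
    coev-slide = begin
      coev (P Z) ⨾ A ▷ braid d s Z ⨾ braid a s (D ⊗₀ Z)  ≈⟨ ⨾⟨ braid-⊙ˡ a d s Z ⟨
      coev (P Z) ⨾ braid (a ⊙ d) s Z                     ≈⟨ braid-slideˡ η↝ s Z ⟩
      braid ∅ s Z ⨾ act₁ s (coev Z)                      ≈⟨ h₁₀ (braid-∅ˡ s Z) ⟩
      act₁ s (coev Z)                                    ∎

    ev-slide : braid s d (A ⊗₀ Z) ⨾ D ▷ braid s a Z ⨾ ev (P Z) ≈ act₁ s (ev Z)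
    ev-slide = begin
      braid s d (A ⊗₀ Z) ⨾ D ▷ braid s a Z ⨾ ev (P Z)    ≈⟨ h₁₂ (braid-⊙ʳ s d a Z) ⟨
      braid s (d ⊙ a) Z ⨾ ev (P Z)                       ≈⟨ braid-slideʳ ε↝ s Z ⟨
      act₁ s (ev Z) ⨾ braid s ∅ Z                        ≈⟨ ≈-trans (⨾⟨ braid-∅ʳ s Z) identityʳ ⟩
      act₁ s (ev Z)                                      ∎

  ev-slide⁻¹ : ∀ Z → D ▷ unbraid d a Z ⨾ unbraid d d (A ⊗₀ Z) ⨾ D ▷ ev Z ≈ ev (D ⊗₀ Z)
  ev-slide⁻¹ Z = begin
    D ▷ unbraid d a Z ⨾ unbraid d d (A ⊗₀ Z) ⨾ D ▷ ev Z
      ≈⟨ ⨾⟨ ⨾⟨ ev-slide d Z ⟨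
    D ▷ unbraid d a Z ⨾ unbraid d d (A ⊗₀ Z) ⨾ braid d d (A ⊗₀ Z) ⨾ D ▷ braid d a Z ⨾ ev (D ⊗₀ Z)
      ≈⟨ ⨾⟨ h₂₀ (braid-isoʳ d d _) ⟩
    D ▷ unbraid d a Z ⨾ D ▷ braid d a Z ⨾ ev (D ⊗₀ Z)
      ≈⟨ h₂₀ (▷₂₀ (braid-isoʳ d a _)) ⟩
    ev (D ⊗₀ Z) ∎

  -- The Yang-Baxter relation with one crossing inverted: the third strand slides over `σ⁻¹ D A` by
  -- naturality of the braiding.
  unbraid-yang-baxter : ∀ Z →
    unbraid d a (D ⊗₀ Z) ⨾ D ▷ braid a d Z
      ≈ A ▷ braid d d Z ⨾ braid a d (D ⊗₀ Z) ⨾ D ▷ unbraid d a Z ⨾ unbraid d d (A ⊗₀ Z)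
  unbraid-yang-baxter Z = begin
    unbraid d a (D ⊗₀ Z) ⨾ D ▷ braid a d Z
      ≈⟨ ⨾⟨ ≈-trans (⨾⟨ braid-isoˡ d d _) identityʳ ⟨
    unbraid d a (D ⊗₀ Z) ⨾ D ▷ braid a d Z ⨾ braid d d (A ⊗₀ Z) ⨾ unbraid d d (A ⊗₀ Z)
      ≈⟨ ⨾⟨ h₂₁ (≈-sym (braid-⊙ˡ d a d Z)) ⟩
    unbraid d a (D ⊗₀ Z) ⨾ braid (d ⊙ a) d Z ⨾ unbraid d d (A ⊗₀ Z)
      ≈⟨ h₂₂ (braid-slideˡ (σ⁻¹↝ d a) d Z) ⟩
    braid (a ⊙ d) d Z ⨾ D ▷ unbraid d a Z ⨾ unbraid d d (A ⊗₀ Z)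
      ≈⟨ h₁₂ (braid-⊙ˡ a d d Z) ⟩
    A ▷ braid d d Z ⨾ braid a d (D ⊗₀ Z) ⨾ D ▷ unbraid d a Z ⨾ unbraid d d (A ⊗₀ Z) ∎

  -- Once the crossings have been slid off cup and cap, what remains is the transpose of the twist
  -- on `A` followed by the inverse twist on `D`. These cancel by `θ-dual`.
  rcoev-rev : ∀ Z → rcoev (D ⊗₀ Z) ⨾ D ▷ rev Z ≈ id
  rcoev-rev Z = begin
    (coev (D ⊗₀ Z) ⨾ A ▷ untwist d (D ⊗₀ Z) ⨾ unbraid d a (D ⊗₀ Z)) ⨾ D ▷ rev Z
      ≈⟨ ≈-trans assoc (⨾⟨ assoc) ⟩
    coev (D ⊗₀ Z) ⨾ A ▷ untwist d (D ⊗₀ Z) ⨾ unbraid d a (D ⊗₀ Z) ⨾ D ▷ rev Z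
      ≈⟨ ⨾⟨ ⨾⟨ ⨾⟨ ▷₁₃ ⟩
    coev (D ⊗₀ Z) ⨾ A ▷ untwist d (D ⊗₀ Z) ⨾ unbraid d a (D ⊗₀ Z)
      ⨾ D ▷ braid a d Z ⨾ D ▷ D ▷ twist a Z ⨾ D ▷ ev Z
      ≈⟨ ⨾⟨ ⨾⟨ ≈-trans (h₂₁ (unbraid-yang-baxter Z)) (≈-trans assoc (⨾⟨ ≈-trans assoc (⨾⟨ assoc))) ⟩
    coev (D ⊗₀ Z) ⨾ A ▷ untwist d (D ⊗₀ Z) ⨾ A ▷ braid d d Z ⨾ braid a d (D ⊗₀ Z)
      ⨾ D ▷ unbraid d a Z ⨾ unbraid d d (A ⊗₀ Z) ⨾ D ▷ D ▷ twist a Z ⨾ D ▷ ev Z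
      ≈⟨ ⨾⟨ h₂₂ (▷₂₂ (braid-slideˡ (θ⁻¹↝ d) d Z)) ⟩
    coev (D ⊗₀ Z) ⨾ A ▷ braid d d Z ⨾ A ▷ D ▷ untwist d Z ⨾ braid a d (D ⊗₀ Z)
      ⨾ D ▷ unbraid d a Z ⨾ unbraid d d (A ⊗₀ Z) ⨾ D ▷ D ▷ twist a Z ⨾ D ▷ ev Z
      ≈⟨ ⨾⟨ ⨾⟨ h₂₂ (↝-natural (σ↝ a d) _) ⟩
    coev (D ⊗₀ Z) ⨾ A ▷ braid d d Z ⨾ braid a d (D ⊗₀ Z) ⨾ D ▷ A ▷ untwist d Z
      ⨾ D ▷ unbraid d a Z ⨾ unbraid d d (A ⊗₀ Z) ⨾ D ▷ D ▷ twist a Z ⨾ D ▷ ev Z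
      ≈⟨ h₃₁ (coev-slide d Z) ⟩
    D ▷ coev Z ⨾ D ▷ A ▷ untwist d Z ⨾ D ▷ unbraid d a Z ⨾ unbraid d d (A ⊗₀ Z)
      ⨾ D ▷ D ▷ twist a Z ⨾ D ▷ ev Z
      ≈⟨ ⨾⟨ ⨾⟨ ⨾⟨ h₂₂ (≈-sym (↝-natural (σ⁻¹↝ d d) _)) ⟩
    D ▷ coev Z ⨾ D ▷ A ▷ untwist d Z ⨾ D ▷ unbraid d a Z ⨾ D ▷ D ▷ twist a Z
      ⨾ unbraid d d (A ⊗₀ Z) ⨾ D ▷ ev Z
      ≈⟨ ⨾⟨ ⨾⟨ h₂₂ (▷₂₂ unbraid-twist) ⟩
    D ▷ coev Z ⨾ D ▷ A ▷ untwist d Z ⨾ D ▷ twist a (D ⊗₀ Z) ⨾ D ▷ unbraid d a Z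
      ⨾ unbraid d d (A ⊗₀ Z) ⨾ D ▷ ev Z
      ≈⟨ ⨾⟨ ⨾⟨ ⨾⟨ ev-slide⁻¹ Z ⟩
    D ▷ coev Z ⨾ D ▷ A ▷ untwist d Z ⨾ D ▷ twist a (D ⊗₀ Z) ⨾ ev (D ⊗₀ Z)
      ≈⟨ ⨾⟨ h₂₂ (▷₂₂ (↝-natural (θ↝ a) _)) ⟩
    D ▷ coev Z ⨾ D ▷ twist a (D ⊗₀ Z) ⨾ D ▷ A ▷ untwist d Z ⨾ ev (D ⊗₀ Z)
      ≈⟨ ⨾⟨ ⨾⟨ ev-natural _ ⟩
    D ▷ coev Z ⨾ D ▷ twist a (D ⊗₀ Z) ⨾ ev (D ⊗₀ Z) ⨾ untwist d Z
      ≈⟨ h₃₁ (twist-dual Z) ⟩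
    twist d Z ⨾ untwist d Z
      ≈⟨ twist-isoˡ d Z ⟩
    id ∎
    where
    unbraid-twist : unbraid d a Z ⨾ D ▷ twist a Z ≈ twist a (D ⊗₀ Z) ⨾ unbraid d a Z
    unbraid-twist =
      square-inverse (braid-isoʳ d a Z) (braid-isoˡ d a Z) (≈-sym (braid-slideʳ (θ↝ a) d Z))

  -- Balance splits the twist on `A ⊗ A` into two crossings around two single twists. The first
  -- crossing slides out past `D`, the second lets the cap move across the other strand, and one
  -- twist stays on the uncapped strand, ready to enter a second cap.
  rev-⊙ : ∀ Z →
    braid (a ⊙ a) d Z ⨾ D ▷ twist (a ⊙ a) Z ⨾ ev (A ⊗₀ Z)
      ≈ braid a a (D ⊗₀ Z) ⨾ A ▷ rev Z ⨾ twist a Z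
  rev-⊙ Z = begin
    braid (a ⊙ a) d Z ⨾ D ▷ twist (a ⊙ a) Z ⨾ ev (A ⊗₀ Z)
      ≈⟨ ⨾⟨ h₁₁ (▷-resp (twist-⊙ a a Z)) ⟩
    braid (a ⊙ a) d Z
      ⨾ D ▷ (braid a a Z ⨾ A ▷ twist a Z ⨾ twist a (A ⊗₀ Z) ⨾ braid a a Z) ⨾ ev (A ⊗₀ Z)
      ≈⟨ ⨾⟨ ≈-trans (h₁₂ ▷-⨾) (⨾⟨ h₁₃ ▷₁₃) ⟩
    braid (a ⊙ a) d Z ⨾ D ▷ braid a a Z ⨾ D ▷ A ▷ twist a Z ⨾ D ▷ twist a (A ⊗₀ Z)
      ⨾ D ▷ braid a a Z ⨾ ev (A ⊗₀ Z)
      ≈⟨ h₂₂ (≈-sym (braid-slideˡ (σ↝ a a) d Z)) ⟩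
    braid a a (D ⊗₀ Z) ⨾ braid (a ⊙ a) d Z ⨾ D ▷ A ▷ twist a Z ⨾ D ▷ twist a (A ⊗₀ Z)
      ⨾ D ▷ braid a a Z ⨾ ev (A ⊗₀ Z)
      ≈⟨ ⨾⟨ h₁₂ (braid-⊙ˡ a a d Z) ⟩
    braid a a (D ⊗₀ Z) ⨾ A ▷ braid a d Z ⨾ braid a d (A ⊗₀ Z) ⨾ D ▷ A ▷ twist a Z
      ⨾ D ▷ twist a (A ⊗₀ Z) ⨾ D ▷ braid a a Z ⨾ ev (A ⊗₀ Z)
      ≈⟨ ⨾⟨ ⨾⟨ h₂₂ (≈-sym (↝-natural (σ↝ a d) _)) ⟩
    braid a a (D ⊗₀ Z) ⨾ A ▷ braid a d Z ⨾ A ▷ D ▷ twist a Z ⨾ braid a d (A ⊗₀ Z)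
      ⨾ D ▷ twist a (A ⊗₀ Z) ⨾ D ▷ braid a a Z ⨾ ev (A ⊗₀ Z)
      ≈⟨ ⨾⟨ ⨾⟨ ⨾⟨ h₂₂ (≈-sym (braid-slideˡ (θ↝ a) d _)) ⟩
    braid a a (D ⊗₀ Z) ⨾ A ▷ braid a d Z ⨾ A ▷ D ▷ twist a Z ⨾ twist a (D ⊗₀ A ⊗₀ Z)
      ⨾ braid a d (A ⊗₀ Z) ⨾ D ▷ braid a a Z ⨾ ev (A ⊗₀ Z)
      ≈⟨ ⨾⟨ ⨾⟨ ⨾⟨ ⨾⟨ ev-slide a Z ⟩
    braid a a (D ⊗₀ Z) ⨾ A ▷ braid a d Z ⨾ A ▷ D ▷ twist a Z ⨾ twist a (D ⊗₀ A ⊗₀ Z) ⨾ A ▷ ev Z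
      ≈⟨ ⨾⟨ ⨾⟨ ⨾⟨ ↝-natural (θ↝ a) _ ⟨
    braid a a (D ⊗₀ Z) ⨾ A ▷ braid a d Z ⨾ A ▷ D ▷ twist a Z ⨾ A ▷ ev Z ⨾ twist a Z
      ≈⟨ ⨾⟨ h₃₁ (≈-sym ▷₁₃) ⟩
    braid a a (D ⊗₀ Z) ⨾ A ▷ rev Z ⨾ twist a Z ∎

  -- The left-hand side is the analogue of rev for A ⊗ A and its dual D ⊗ D.
  rev-⊙-nested : ∀ Z →
    braid (a ⊙ a) d (D ⊗₀ Z) ⨾ D ▷ braid (a ⊙ a) d Z ⨾ D ▷ D ▷ twist (a ⊙ a) Z
      ⨾ D ▷ ev (A ⊗₀ Z) ⨾ ev Z
    ≈ A ▷ rev (D ⊗₀ Z) ⨾ rev Z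
  rev-⊙-nested Z = begin
    braid (a ⊙ a) d (D ⊗₀ Z) ⨾ D ▷ braid (a ⊙ a) d Z ⨾ D ▷ D ▷ twist (a ⊙ a) Z
      ⨾ D ▷ ev (A ⊗₀ Z) ⨾ ev Z
      ≈⟨ ⨾⟨ h₃₃ (≈-trans (≈-sym ▷₁₃) (≈-trans (▷-resp (rev-⊙ Z)) ▷₁₃)) ⟩
    braid (a ⊙ a) d (D ⊗₀ Z) ⨾ D ▷ braid a a (D ⊗₀ Z) ⨾ D ▷ A ▷ rev Z ⨾ D ▷ twist a Z ⨾ ev Z
      ≈⟨ h₁₂ (braid-⊙ˡ a a d _) ⟩
    A ▷ braid a d (D ⊗₀ Z) ⨾ braid a d (A ⊗₀ D ⊗₀ Z) ⨾ D ▷ braid a a (D ⊗₀ Z)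
      ⨾ D ▷ A ▷ rev Z ⨾ D ▷ twist a Z ⨾ ev Z
      ≈⟨ ⨾⟨ ⨾⟨ ⨾⟨ h₂₂ (▷₂₂ (↝-natural (θ↝ a) _)) ⟩
    A ▷ braid a d (D ⊗₀ Z) ⨾ braid a d (A ⊗₀ D ⊗₀ Z) ⨾ D ▷ braid a a (D ⊗₀ Z)
      ⨾ D ▷ twist a (A ⊗₀ D ⊗₀ Z) ⨾ D ▷ A ▷ rev Z ⨾ ev Z
      ≈⟨ ⨾⟨ ⨾⟨ ⨾⟨ ⨾⟨ ev-natural _ ⟩
    A ▷ braid a d (D ⊗₀ Z) ⨾ braid a d (A ⊗₀ D ⊗₀ Z) ⨾ D ▷ braid a a (D ⊗₀ Z)
      ⨾ D ▷ twist a (A ⊗₀ D ⊗₀ Z) ⨾ ev (A ⊗₀ D ⊗₀ Z) ⨾ rev Z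
      ≈⟨ ⨾⟨ ⨾⟨ h₂₂ (▷₂₂ (≈-sym (braid-slideʳ (θ↝ a) a _))) ⟩
    A ▷ braid a d (D ⊗₀ Z) ⨾ braid a d (A ⊗₀ D ⊗₀ Z) ⨾ D ▷ A ▷ twist a (D ⊗₀ Z)
      ⨾ D ▷ braid a a (D ⊗₀ Z) ⨾ ev (A ⊗₀ D ⊗₀ Z) ⨾ rev Z
      ≈⟨ ⨾⟨ h₂₂ (≈-sym (↝-natural (σ↝ a d) _)) ⟩
    A ▷ braid a d (D ⊗₀ Z) ⨾ A ▷ D ▷ twist a (D ⊗₀ Z) ⨾ braid a d (A ⊗₀ D ⊗₀ Z)
      ⨾ D ▷ braid a a (D ⊗₀ Z) ⨾ ev (A ⊗₀ D ⊗₀ Z) ⨾ rev Z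
      ≈⟨ ⨾⟨ ⨾⟨ h₃₁ (ev-slide a _) ⟩
    A ▷ braid a d (D ⊗₀ Z) ⨾ A ▷ D ▷ twist a (D ⊗₀ Z) ⨾ A ▷ ev (D ⊗₀ Z) ⨾ rev Z
      ≈⟨ h₃₁ (≈-sym ▷₁₃) ⟩
    A ▷ rev (D ⊗₀ Z) ⨾ rev Z ∎

-- Application and abstraction on a reflexive object

module Reflexive {o ℓ e} (R : RibbonCategory o ℓ e) (RA : ReflexiveObject R) where
  open RibbonOps R hiding (twist)
  open ReflexiveObject RA
  open Internal R RA
  open CategoryReasoning category
  open HomReasoning
  open Strictification monoidal
  open Braiding R
  open Duality R A

  private variable P Q : Obj → Obj

  fold : ∀ Z → (A ⊗₀ D ⊗₀ Z) ⇒ (A ⊗₀ Z)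
  fold = hat (a ⊙ d) a φ

  unfold : ∀ Z → (A ⊗₀ Z) ⇒ (A ⊗₀ D ⊗₀ Z)
  unfold = hat a (a ⊙ d) φ⁻¹

  φ↝ : Denotes (a ⊙ d) a φ fold
  φ↝ = ↝-refl

  φ⁻¹↝ : Denotes a (a ⊙ d) φ⁻¹ unfold
  φ⁻¹↝ = ↝-refl

  fold-unfold : ∀ Z → fold Z ⨾ unfold Z ≈ id
  fold-unfold = ↝-unique (φ↝ ⨾↝ φ⁻¹↝) (↝-id (a ⊙ d)) φ-isoˡ

  unfold-fold : ∀ Z → unfold Z ⨾ fold Z ≈ id
  unfold-fold = ↝-unique (φ⁻¹↝ ⨾↝ φ↝) (↝-id a) φ-isoʳ

  apply : ∀ Z → (A ⊗₀ A ⊗₀ Z) ⇒ (A ⊗₀ Z)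
  apply Z = unfold (A ⊗₀ Z) ⨾ A ▷ ev Z

  app↝ : Denotes (a ⊙ a) a app apply
  app↝ = ↝-◁ a φ⁻¹↝ ⨾↝ α↝ a d a ˢ⨾↝ ↝-▷ a ε↝ ⨾↝ˢ ru↝ a

  apply-natural : ∀ {X Y} (f : X ⇒ Y) → A ▷ A ▷ f ⨾ apply Y ≈ apply X ⨾ A ▷ f
  apply-natural = ↝-natural app↝

  -- The input is the body; the outputs are the function and its bound variable.
  abstr : ∀ Z → (A ⊗₀ Z) ⇒ (A ⊗₀ A ⊗₀ Z)
  abstr Z = A ▷ rcoev Z ⨾ fold (A ⊗₀ Z)

  lam↝ : Denotes a (a ⊙ a) lam abstr
  lam↝ = (ru⁻¹↝ a ˢ⨾↝ ↝-▷ a η↝ ⨾↝ ↝-▷ a (↝-▷ a (θ⁻¹↝ d)) ⨾↝ ↝-▷ a (σ⁻¹↝ d a)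
            ⨾↝ α⁻¹↝ a d a ˢ⨾↝ ↝-◁ a φ↝)
         ↝≈ λ _ → h₃₁ (≈-sym ▷₁₃)

  abstr-natural : ∀ {X Y} (f : X ⇒ Y) → A ▷ f ⨾ abstr Y ≈ abstr X ⨾ A ▷ A ▷ f
  abstr-natural = ↝-natural lam↝

  -- The β-rule for currying by `coev` and `fold`; `coev-apply-fold` is the matching η-rule.
  fold-apply : ∀ Z → fold (A ⊗₀ Z) ⨾ apply Z ≈ A ▷ ev Z
  fold-apply Z = h₂₀ (fold-unfold _)

  coev-apply-fold : ∀ Z → A ▷ coev Z ⨾ apply (D ⊗₀ Z) ⨾ fold Z ≈ id
  coev-apply-fold Z = begin
    A ▷ coev Z ⨾ (unfold (A ⊗₀ D ⊗₀ Z) ⨾ A ▷ ev (D ⊗₀ Z)) ⨾ fold Z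
      ≈⟨ ⨾⟨ assoc ⟩
    A ▷ coev Z ⨾ unfold (A ⊗₀ D ⊗₀ Z) ⨾ A ▷ ev (D ⊗₀ Z) ⨾ fold Z
      ≈⟨ h₂₂ (↝-natural φ⁻¹↝ _) ⟩
    unfold Z ⨾ A ▷ D ▷ coev Z ⨾ A ▷ ev (D ⊗₀ Z) ⨾ fold Z
      ≈⟨ ⨾⟨ h₂₀ (▷₂₀ (ev-coev Z)) ⟩
    unfold Z ⨾ fold Z
      ≈⟨ unfold-fold Z ⟩
    id ∎

  -- When the variable output runs straight into the cap of the trace, the snake equation
  -- `rcoev-rev` straightens it and the abstraction becomes `fold`.
  abstr-rev : ∀ Z → abstr (D ⊗₀ Z) ⨾ A ▷ rev Z ≈ fold Z
  abstr-rev Z = begin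
    (A ▷ rcoev (D ⊗₀ Z) ⨾ fold (A ⊗₀ D ⊗₀ Z)) ⨾ A ▷ rev Z    ≈⟨ assoc ⟩
    A ▷ rcoev (D ⊗₀ Z) ⨾ fold (A ⊗₀ D ⊗₀ Z) ⨾ A ▷ rev Z      ≈⟨ ⨾⟨ ↝-natural φ↝ _ ⟨
    A ▷ rcoev (D ⊗₀ Z) ⨾ A ▷ D ▷ rev Z ⨾ fold Z              ≈⟨ h₂₀ (▷₂₀ (rcoev-rev Z)) ⟩
    fold Z                                                   ∎

  -- The transpose of `app`, with `D ⊗ D` as the dual of `A ⊗ A` in reversed order; `apply-ev` is
  -- its characteristic property.
  applyᵗ : ∀ Z → (D ⊗₀ Z) ⇒ (D ⊗₀ D ⊗₀ Z)
  applyᵗ Z = D ▷ coev Z ⨾ D ▷ A ▷ coev (D ⊗₀ Z) ⨾ D ▷ apply (D ⊗₀ D ⊗₀ Z) ⨾ ev (D ⊗₀ D ⊗₀ Z)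

  applyᵗ↝ : ∃ λ f → Denotes d (d ⊙ d) f applyᵗ
  -- The morphism itself is left to unification. Its existence is what makes `applyᵗ` natural and
  -- lets braidings slide past it.
  applyᵗ↝ = _ ,
    (ru⁻¹↝ d ˢ⨾↝ ↝-▷ d η↝ ⨾↝ ↝-▷ˢ d (↝-▷ˢ a (lu⁻¹↝ d)) ˢ⨾↝ ↝-▷ d (↝-▷ a (↝-◁ d η↝))
      ⨾↝ ↝-▷ˢ d (↝-▷ˢ a (α↝ a d d)) ˢ⨾↝ ↝-▷ˢ d (α⁻¹↝ a a (d ⊙ d)) ˢ⨾↝ ↝-▷ d (↝-◁ (d ⊙ d) app↝)
      ⨾↝ α⁻¹↝ d a (d ⊙ d) ˢ⨾↝ ↝-◁ (d ⊙ d) ε↝ ⨾↝ˢ lu↝ (d ⊙ d))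

  apply-ev : ∀ Z → D ▷ apply Z ⨾ ev Z ≈ applyᵗ (A ⊗₀ A ⊗₀ Z) ⨾ D ▷ ev (A ⊗₀ Z) ⨾ ev Z
  apply-ev Z = ≈-sym (begin
    (D ▷ coev W ⨾ D ▷ A ▷ coev (D ⊗₀ W) ⨾ D ▷ apply (D ⊗₀ D ⊗₀ W) ⨾ ev (D ⊗₀ D ⊗₀ W))
      ⨾ D ▷ ev (A ⊗₀ Z) ⨾ ev Z
      ≈⟨ ≈-trans assoc (⨾⟨ ≈-trans assoc (⨾⟨ assoc)) ⟩
    D ▷ coev W ⨾ D ▷ A ▷ coev (D ⊗₀ W) ⨾ D ▷ apply (D ⊗₀ D ⊗₀ W) ⨾ ev (D ⊗₀ D ⊗₀ W)
      ⨾ D ▷ ev (A ⊗₀ Z) ⨾ ev Z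
      ≈⟨ ⨾⟨ ⨾⟨ ⨾⟨ h₂₂ (≈-sym (ev-natural _)) ⟩
    D ▷ coev W ⨾ D ▷ A ▷ coev (D ⊗₀ W) ⨾ D ▷ apply (D ⊗₀ D ⊗₀ W) ⨾ D ▷ A ▷ D ▷ ev (A ⊗₀ Z)
      ⨾ ev (D ⊗₀ A ⊗₀ Z) ⨾ ev Z
      ≈⟨ ⨾⟨ ⨾⟨ ⨾⟨ ⨾⟨ ≈-sym (ev-natural _) ⟩
    D ▷ coev W ⨾ D ▷ A ▷ coev (D ⊗₀ W) ⨾ D ▷ apply (D ⊗₀ D ⊗₀ W) ⨾ D ▷ A ▷ D ▷ ev (A ⊗₀ Z)
      ⨾ D ▷ A ▷ ev Z ⨾ ev Z
      ≈⟨ ⨾⟨ ⨾⟨ h₂₂ (▷₂₂ (≈-sym (apply-natural _))) ⟩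
    D ▷ coev W ⨾ D ▷ A ▷ coev (D ⊗₀ W) ⨾ D ▷ A ▷ A ▷ D ▷ ev (A ⊗₀ Z) ⨾ D ▷ apply (D ⊗₀ A ⊗₀ Z)
      ⨾ D ▷ A ▷ ev Z ⨾ ev Z
      ≈⟨ ⨾⟨ h₂₂ (▷₂₂ (▷₂₂ (≈-sym (coev-natural _)))) ⟩
    D ▷ coev W ⨾ D ▷ A ▷ ev (A ⊗₀ Z) ⨾ D ▷ A ▷ coev (A ⊗₀ Z) ⨾ D ▷ apply (D ⊗₀ A ⊗₀ Z)
      ⨾ D ▷ A ▷ ev Z ⨾ ev Z
      ≈⟨ h₂₀ (▷₂₀ (coev-ev (A ⊗₀ Z))) ⟩
    D ▷ A ▷ coev (A ⊗₀ Z) ⨾ D ▷ apply (D ⊗₀ A ⊗₀ Z) ⨾ D ▷ A ▷ ev Z ⨾ ev Z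
      ≈⟨ ⨾⟨ h₂₂ (▷₂₂ (≈-sym (apply-natural _))) ⟩
    D ▷ A ▷ coev (A ⊗₀ Z) ⨾ D ▷ A ▷ A ▷ ev Z ⨾ D ▷ apply Z ⨾ ev Z
      ≈⟨ h₂₀ (▷₂₀ (▷₂₀ (coev-ev Z))) ⟩
    D ▷ apply Z ⨾ ev Z ∎)
    where W = A ⊗₀ A ⊗₀ Z

  -- An application that meets the cap is pushed through braid and twist and reappears transposed on
  -- the `D` strand. The twist on `A` has then become a twist on `A ⊗ A`, which `rev-⊙-nested`
  -- resolves into two caps.
  apply-rev : ∀ Z → apply (D ⊗₀ Z) ⨾ rev Z ≈ A ▷ A ▷ applyᵗ Z ⨾ A ▷ rev (D ⊗₀ Z) ⨾ rev Z
  apply-rev Z = begin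
    apply (D ⊗₀ Z) ⨾ braid a d Z ⨾ D ▷ twist a Z ⨾ ev Z
      ≈⟨ h₂₂ (braid-slideˡ app↝ d Z) ⟩
    braid (a ⊙ a) d Z ⨾ D ▷ apply Z ⨾ D ▷ twist a Z ⨾ ev Z
      ≈⟨ ⨾⟨ h₂₂ (▷₂₂ (twist-slide app↝ Z)) ⟩
    braid (a ⊙ a) d Z ⨾ D ▷ twist (a ⊙ a) Z ⨾ D ▷ apply Z ⨾ ev Z
      ≈⟨ ⨾⟨ ⨾⟨ apply-ev Z ⟩
    braid (a ⊙ a) d Z ⨾ D ▷ twist (a ⊙ a) Z ⨾ applyᵗ (A ⊗₀ A ⊗₀ Z) ⨾ D ▷ ev (A ⊗₀ Z) ⨾ ev Z
      ≈⟨ ⨾⟨ h₂₂ (↝-natural (proj₂ applyᵗ↝) _) ⟩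
    braid (a ⊙ a) d Z ⨾ applyᵗ (A ⊗₀ A ⊗₀ Z) ⨾ D ▷ D ▷ twist (a ⊙ a) Z ⨾ D ▷ ev (A ⊗₀ Z) ⨾ ev Z
      ≈⟨ h₂₂ (≈-sym (braid-slideʳ (proj₂ applyᵗ↝) (a ⊙ a) Z)) ⟩
    A ▷ A ▷ applyᵗ Z ⨾ braid (a ⊙ a) (d ⊙ d) Z ⨾ D ▷ D ▷ twist (a ⊙ a) Z ⨾ D ▷ ev (A ⊗₀ Z) ⨾ ev Z
      ≈⟨ ⨾⟨ h₁₂ (braid-⊙ʳ (a ⊙ a) d d Z) ⟩
    A ▷ A ▷ applyᵗ Z ⨾ braid (a ⊙ a) d (D ⊗₀ Z) ⨾ D ▷ braid (a ⊙ a) d Z ⨾ D ▷ D ▷ twist (a ⊙ a) Z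
      ⨾ D ▷ ev (A ⊗₀ Z) ⨾ ev Z
      ≈⟨ ⨾⟨ rev-⊙-nested Z ⟩
    A ▷ A ▷ applyᵗ Z ⨾ A ▷ rev (D ⊗₀ Z) ⨾ rev Z ∎

  -- The second half of the way round the loop: by the snake equation, a transposed application on
  -- the `D` leg of the cup is an ordinary application on its `A` leg.
  coev-applyᵗ : ∀ Z → coev Z ⨾ A ▷ applyᵗ Z ≈ coev Z ⨾ A ▷ coev (D ⊗₀ Z) ⨾ apply (D ⊗₀ D ⊗₀ Z)
  coev-applyᵗ Z = begin
    coev Z ⨾ A ▷ applyᵗ Z
      ≈⟨ ⨾⟨ ≈-trans ▷-⨾ (⨾⟨ ▷₁₃) ⟩
    coev Z ⨾ A ▷ D ▷ coev Z ⨾ A ▷ D ▷ A ▷ coev (D ⊗₀ Z) ⨾ A ▷ D ▷ apply (D ⊗₀ D ⊗₀ Z)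
      ⨾ A ▷ ev (D ⊗₀ D ⊗₀ Z)
      ≈⟨ h₂₂ (≈-sym (coev-natural _)) ⟩
    coev Z ⨾ coev (A ⊗₀ D ⊗₀ Z) ⨾ A ▷ D ▷ A ▷ coev (D ⊗₀ Z) ⨾ A ▷ D ▷ apply (D ⊗₀ D ⊗₀ Z)
      ⨾ A ▷ ev (D ⊗₀ D ⊗₀ Z)
      ≈⟨ ⨾⟨ h₂₂ (≈-sym (coev-natural _)) ⟩
    coev Z ⨾ A ▷ coev (D ⊗₀ Z) ⨾ coev (A ⊗₀ A ⊗₀ D ⊗₀ D ⊗₀ Z) ⨾ A ▷ D ▷ apply (D ⊗₀ D ⊗₀ Z)
      ⨾ A ▷ ev (D ⊗₀ D ⊗₀ Z)
      ≈⟨ ⨾⟨ ⨾⟨ h₂₂ (≈-sym (coev-natural _)) ⟩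
    coev Z ⨾ A ▷ coev (D ⊗₀ Z) ⨾ apply (D ⊗₀ D ⊗₀ Z) ⨾ coev (A ⊗₀ D ⊗₀ D ⊗₀ Z)
      ⨾ A ▷ ev (D ⊗₀ D ⊗₀ Z)
      ≈⟨ ⨾⟨ ⨾⟨ ≈-trans (⨾⟨ coev-ev _) identityʳ ⟩
    coev Z ⨾ A ▷ coev (D ⊗₀ Z) ⨾ apply (D ⊗₀ D ⊗₀ Z) ∎

  -- The η-rule for functions abstracted through the trace.
  abstr-apply : (M : ∀ Z → (A ⊗₀ Z) ⇒ (A ⊗₀ A ⊗₀ Z)) →
    (∀ {X Y} (f : X ⇒ Y) → A ▷ f ⨾ M Y ≈ M X ⨾ A ▷ A ▷ f) →
    ∀ Z → coev Z ⨾ abstr (D ⊗₀ Z) ⨾ M (A ⊗₀ D ⊗₀ Z) ⨾ A ▷ apply (D ⊗₀ Z) ⨾ A ▷ rev Z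
          ≈ coev Z ⨾ M (D ⊗₀ Z) ⨾ A ▷ rev Z
  abstr-apply M M-natural Z = begin
    coev Z ⨾ abstr (D ⊗₀ Z) ⨾ M (A ⊗₀ D ⊗₀ Z) ⨾ A ▷ apply (D ⊗₀ Z) ⨾ A ▷ rev Z
      ≈⟨ ⨾⟨ ⨾⟨ ⨾⟨ ≈-trans (▷₂₁ (apply-rev Z)) ▷₁₃ ⟩
    coev Z ⨾ abstr (D ⊗₀ Z) ⨾ M (A ⊗₀ D ⊗₀ Z) ⨾ A ▷ A ▷ A ▷ applyᵗ Z ⨾ A ▷ A ▷ rev (D ⊗₀ Z)
      ⨾ A ▷ rev Z
      ≈⟨ ⨾⟨ ⨾⟨ h₂₂ (≈-sym (M-natural _)) ⟩
    coev Z ⨾ abstr (D ⊗₀ Z) ⨾ A ▷ A ▷ applyᵗ Z ⨾ M (A ⊗₀ D ⊗₀ D ⊗₀ Z) ⨾ A ▷ A ▷ rev (D ⊗₀ Z)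
      ⨾ A ▷ rev Z
      ≈⟨ ⨾⟨ h₂₂ (≈-sym (abstr-natural _)) ⟩
    coev Z ⨾ A ▷ applyᵗ Z ⨾ abstr (D ⊗₀ D ⊗₀ Z) ⨾ M (A ⊗₀ D ⊗₀ D ⊗₀ Z) ⨾ A ▷ A ▷ rev (D ⊗₀ Z)
      ⨾ A ▷ rev Z
      ≈⟨ h₂₃ (coev-applyᵗ Z) ⟩
    coev Z ⨾ A ▷ coev (D ⊗₀ Z) ⨾ apply (D ⊗₀ D ⊗₀ Z) ⨾ abstr (D ⊗₀ D ⊗₀ Z)
      ⨾ M (A ⊗₀ D ⊗₀ D ⊗₀ Z) ⨾ A ▷ A ▷ rev (D ⊗₀ Z) ⨾ A ▷ rev Z
      ≈⟨ ⨾⟨ ⨾⟨ ⨾⟨ ⨾⟨ h₂₂ (≈-sym (M-natural _)) ⟩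
    coev Z ⨾ A ▷ coev (D ⊗₀ Z) ⨾ apply (D ⊗₀ D ⊗₀ Z) ⨾ abstr (D ⊗₀ D ⊗₀ Z) ⨾ A ▷ rev (D ⊗₀ Z)
      ⨾ M (D ⊗₀ Z) ⨾ A ▷ rev Z
      ≈⟨ ⨾⟨ ⨾⟨ ⨾⟨ h₂₁ (abstr-rev _) ⟩
    coev Z ⨾ A ▷ coev (D ⊗₀ Z) ⨾ apply (D ⊗₀ D ⊗₀ Z) ⨾ fold (D ⊗₀ Z) ⨾ M (D ⊗₀ Z) ⨾ A ▷ rev Z
      ≈⟨ ⨾⟨ ≈-trans (h₃₁ (coev-apply-fold _)) identityˡ ⟩
    coev Z ⨾ M (D ⊗₀ Z) ⨾ A ▷ rev Z ∎

  Aⁿ : ℕ → Obj → Obj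
  Aⁿ zero Z = Z
  Aⁿ (suc n) Z = A ⊗₀ Aⁿ n Z

  pow-presentation : ∀ n → Presentation (pow n) (Aⁿ n)
  pow-presentation zero = presentation ∅
  pow-presentation (suc zero) = presentation a
  pow-presentation (suc (suc n)) = presentation (a ⊙ presented (pow-presentation (suc n)))

  pw : ∀ n → Shape (Aⁿ n)
  pw n = presented (pow-presentation n)

  act₁-suc : ∀ n {X Y} (f : X ⇒ Y) → act₁ (pw (suc n)) f ≈ A ▷ act₁ (pw n) f
  act₁-suc zero f = ≈-refl
  act₁-suc (suc n) f = ≈-refl

  -- `pow 1` is `A` itself, so the cases 0 and 1 differ from the rest. The presentations behind the
  -- shapes agree definitionally while the shapes do not, hence the repacking by `denotes`.
  cons↝ : ∀ n → Denotes (a ⊙ pw n) (pw (suc n)) (cons n) (λ _ → id)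
  cons↝ zero = denotes (at (ru↝ a))
  cons↝ (suc n) = denotes (at (↝-id (a ⊙ pw (suc n))))

  uncons↝ : ∀ n → Denotes (pw (suc n)) (a ⊙ pw n) (uncons n) (λ _ → id)
  uncons↝ zero = denotes (at (ru⁻¹↝ a))
  uncons↝ (suc n) = denotes (at (↝-id (a ⊙ pw (suc n))))

  apply* : ∀ n Z → Aⁿ (suc n) Z ⇒ (A ⊗₀ Z)
  apply* zero Z = id
  apply* (suc n) Z = apply (Aⁿ n Z) ⨾ apply* n Z

  app↝* : ∀ n → Denotes (pw (suc n)) a (appₙ n) (apply* n)
  app↝* zero = denotes (at (↝-id a))
  app↝* (suc n) = denotes (at
    (↝-▷ˢ a (uncons↝ n) ˢ⨾↝ α⁻¹↝ a a (pw n) ˢ⨾↝ ↝-◁ (pw n) app↝ ⨾↝ cons↝ n ˢ⨾↝ app↝* n))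

  apply*-natural : ∀ n {X Y} (f : X ⇒ Y) → A ▷ act₁ (pw n) f ⨾ apply* n Y ≈ apply* n X ⨾ A ▷ f
  apply*-natural n f = ≈-trans (h₁₁ (≈-sym (act₁-suc n f))) (↝-natural (app↝* n) f)

  abstr* : ∀ n Z → (A ⊗₀ Z) ⇒ Aⁿ (suc n) Z
  abstr* zero Z = id
  abstr* (suc n) Z = abstr* n Z ⨾ abstr (Aⁿ n Z)

  lam↝* : ∀ n → Denotes a (pw (suc n)) (lamₙ n) (abstr* n)
  lam↝* zero = denotes (at (↝-id a))
  lam↝* (suc n) = denotes (at
    (lam↝* n ⨾↝ uncons↝ n ˢ⨾↝ ↝-◁ (pw n) lam↝ ⨾↝ α↝ a a (pw n) ˢ⨾↝ ↝-▷ˢ a (cons↝ n)))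
    ↝≈ λ _ → ⨾⟨ identityʳ

  Tr↝ : ∀ {s : Shape P} {t : Shape Q} {f v} → Denotes (s ⊙ a) (t ⊙ a) f v →
        Denotes s t (Tr f) (λ Z → act₁ s (coev Z) ⨾ v (D ⊗₀ Z) ⨾ act₁ t (rev Z))
  Tr↝ {s = s} {t} f↝ =
    ru⁻¹↝ s ˢ⨾↝ ↝-▷ s η↝ ⨾↝ α⁻¹↝ s a d ˢ⨾↝ ↝-◁ d f↝ ⨾↝ α↝ t a d ˢ⨾↝ ↝-▷ t rε↝ ⨾↝ˢ ru↝ t

  -- `M` is arbitrary so that the pair next to it, the last `abstr` and the first `apply`, can be
  -- swallowed into a new middle part `M′`. Induction removes the other pairs, and `abstr-apply`
  -- then removes the swallowed one.
  abstr-apply* : ∀ n (M : ∀ Z → (A ⊗₀ Z) ⇒ (A ⊗₀ A ⊗₀ Z)) →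
    (∀ {X Y} (f : X ⇒ Y) → A ▷ f ⨾ M Y ≈ M X ⨾ A ▷ A ▷ f) →
    ∀ Z → coev Z ⨾ abstr* n (D ⊗₀ Z) ⨾ M (Aⁿ n (D ⊗₀ Z)) ⨾ A ▷ apply* n (D ⊗₀ Z) ⨾ A ▷ rev Z
          ≈ coev Z ⨾ M (D ⊗₀ Z) ⨾ A ▷ rev Z
  abstr-apply* zero M M-natural Z = ⨾⟨ ≈-trans identityˡ (⨾⟨ h₁₀ ⊗-identity)
  abstr-apply* (suc n) M M-natural Z = begin
    coev Z ⨾ (abstr* n DZ ⨾ abstr V) ⨾ M (A ⊗₀ V) ⨾ A ▷ (apply V ⨾ apply* n DZ) ⨾ A ▷ rev Z
      ≈⟨ ⨾⟨ assoc ⟩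
    coev Z ⨾ abstr* n DZ ⨾ abstr V ⨾ M (A ⊗₀ V) ⨾ A ▷ (apply V ⨾ apply* n DZ) ⨾ A ▷ rev Z
      ≈⟨ ⨾⟨ ⨾⟨ ⨾⟨ ⨾⟨ h₁₂ ▷-⨾ ⟩
    coev Z ⨾ abstr* n DZ ⨾ abstr V ⨾ M (A ⊗₀ V) ⨾ A ▷ apply V ⨾ A ▷ apply* n DZ ⨾ A ▷ rev Z
      ≈⟨ ⨾⟨ ⨾⟨ h₃₁ ≈-refl ⟩
    coev Z ⨾ abstr* n DZ ⨾ M′ V ⨾ A ▷ apply* n DZ ⨾ A ▷ rev Z
      ≈⟨ abstr-apply* n M′ M′-natural Z ⟩
    coev Z ⨾ M′ DZ ⨾ A ▷ rev Z
      ≈⟨ ⨾⟨ ≈-trans assoc (⨾⟨ assoc) ⟩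
    coev Z ⨾ abstr DZ ⨾ M (A ⊗₀ DZ) ⨾ A ▷ apply DZ ⨾ A ▷ rev Z
      ≈⟨ abstr-apply M M-natural Z ⟩
    coev Z ⨾ M DZ ⨾ A ▷ rev Z ∎
    where
    DZ = D ⊗₀ Z
    V = Aⁿ n DZ
    M′ : ∀ Z → (A ⊗₀ Z) ⇒ (A ⊗₀ A ⊗₀ Z)
    M′ Z = abstr Z ⨾ M (A ⊗₀ Z) ⨾ A ▷ apply Z
    M′-natural : ∀ {X Y} (f : X ⇒ Y) → A ▷ f ⨾ M′ Y ≈ M′ X ⨾ A ▷ A ▷ f
    M′-natural {X} {Y} f = begin
      A ▷ f ⨾ abstr Y ⨾ M (A ⊗₀ Y) ⨾ A ▷ apply Y          ≈⟨ h₂₂ (abstr-natural f) ⟩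
      abstr X ⨾ A ▷ A ▷ f ⨾ M (A ⊗₀ Y) ⨾ A ▷ apply Y      ≈⟨ ⨾⟨ h₂₂ (M-natural _) ⟩
      abstr X ⨾ M (A ⊗₀ X) ⨾ A ▷ A ▷ A ▷ f ⨾ A ▷ apply Y  ≈⟨ ⨾⟨ ⨾⟨ ▷₂₂ (apply-natural f) ⟩
      abstr X ⨾ M (A ⊗₀ X) ⨾ A ▷ apply X ⨾ A ▷ A ▷ f      ≈⟨ ≈-trans assoc (⨾⟨ assoc) ⟨
      (abstr X ⨾ M (A ⊗₀ X) ⨾ A ▷ apply X) ⨾ A ▷ A ▷ f    ∎

-- Currying, extensionality and the uncurried form of `F`

module Combinators {o ℓ e} (R : RibbonCategory o ℓ e) (RA : ReflexiveObject R) where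
  open RibbonOps R hiding (twist)
  open ReflexiveObject RA
  open Internal R RA
  open CategoryReasoning category
  open HomReasoning
  open Strictification monoidal
  open Braiding R
  open Duality R A
  open Reflexive R RA

  private variable P : Obj → Obj

  module _ (s : Shape P) {T U : ∀ Z → P Z ⇒ (A ⊗₀ Z)}
           (T-natural : ∀ {X Y} (f : X ⇒ Y) → act₁ s f ⨾ T Y ≈ T X ⨾ A ▷ f)
           (U-natural : ∀ {X Y} (f : X ⇒ Y) → act₁ s f ⨾ U Y ≈ U X ⨾ A ▷ f) where
    -- Extensionality: naturality moves a fresh variable, supplied by `coev`, past `T`, and the
    -- η-rule recovers `T` from its application to that variable.
    apply-injective : (∀ Z → T (A ⊗₀ Z) ⨾ apply Z ≈ U (A ⊗₀ Z) ⨾ apply Z) → ∀ Z → T Z ≈ U Z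
    apply-injective p Z = begin
      T Z
        ≈⟨ recover T-natural ⟨
      act₁ s (coev Z) ⨾ (T (A ⊗₀ D ⊗₀ Z) ⨾ apply (D ⊗₀ Z)) ⨾ fold Z
        ≈⟨ ⨾⟨ h₁₁ (p _) ⟩
      act₁ s (coev Z) ⨾ (U (A ⊗₀ D ⊗₀ Z) ⨾ apply (D ⊗₀ Z)) ⨾ fold Z
        ≈⟨ recover U-natural ⟩
      U Z ∎
      where
      recover : {V : ∀ Z → P Z ⇒ (A ⊗₀ Z)} →
        (∀ {X Y} (f : X ⇒ Y) → act₁ s f ⨾ V Y ≈ V X ⨾ A ▷ f) →
        act₁ s (coev Z) ⨾ (V (A ⊗₀ D ⊗₀ Z) ⨾ apply (D ⊗₀ Z)) ⨾ fold Z ≈ V Z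
      recover {V} V-natural = begin
        act₁ s (coev Z) ⨾ (V (A ⊗₀ D ⊗₀ Z) ⨾ apply (D ⊗₀ Z)) ⨾ fold Z   ≈⟨ ⨾⟨ assoc ⟩
        act₁ s (coev Z) ⨾ V (A ⊗₀ D ⊗₀ Z) ⨾ apply (D ⊗₀ Z) ⨾ fold Z     ≈⟨ h₂₂ (V-natural _) ⟩
        V Z ⨾ A ▷ coev Z ⨾ apply (D ⊗₀ Z) ⨾ fold Z                      ≈⟨ ⨾⟨ coev-apply-fold Z ⟩
        V Z ⨾ id                                                        ≈⟨ identityʳ ⟩
        V Z                                                             ∎

  apply*-injective : ∀ n (s : Shape P) {T U : ∀ Z → P Z ⇒ (A ⊗₀ Z)} →
    (∀ {X Y} (f : X ⇒ Y) → act₁ s f ⨾ T Y ≈ T X ⨾ A ▷ f) →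
    (∀ {X Y} (f : X ⇒ Y) → act₁ s f ⨾ U Y ≈ U X ⨾ A ▷ f) →
    (∀ Z → T (Aⁿ n Z) ⨾ apply* n Z ≈ U (Aⁿ n Z) ⨾ apply* n Z) → ∀ Z → T Z ≈ U Z
  apply*-injective zero s T-natural U-natural p Z =
    ≈-trans (≈-sym identityʳ) (≈-trans (p Z) identityʳ)
  apply*-injective (suc n) s T-natural U-natural p =
    apply-injective s T-natural U-natural
      (apply*-injective n (s ⊙ a) (lifted T-natural) (lifted U-natural)
        (λ Z → ≈-trans assoc (≈-trans (p Z) (≈-sym assoc))))
    where
    lifted : ∀ {V : ∀ Z → _ ⇒ (A ⊗₀ Z)} → (∀ {X Y} (f : X ⇒ Y) → act₁ s f ⨾ V Y ≈ V X ⨾ A ▷ f) →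
      ∀ {X Y} (f : X ⇒ Y) → act₁ (s ⊙ a) f ⨾ V (A ⊗₀ Y) ⨾ apply Y ≈ (V (A ⊗₀ X) ⨾ apply X) ⨾ A ▷ f
    lifted V-natural f = ≈-trans (h₂₂ (V-natural _))
      (≈-trans (⨾⟨ apply-natural f) (≈-sym assoc))

  -- Unlike in `apply*-injective`, the hypothesis is available at `unit` only. Each application is
  -- turned back into a morphism, so that the induction hypothesis gives an equality of morphisms
  -- and `↝-unique` spreads it over all `Z`.
  hat-apply*-injective : ∀ n (s : Shape P) {f g : obj s ⇒ A} →
    hat s a f (Aⁿ n unit) ⨾ apply* n unit ≈ hat s a g (Aⁿ n unit) ⨾ apply* n unit → f ≈ g
  hat-apply*-injective zero s p =
    hat-injective s a (≈-trans (≈-sym identityʳ) (≈-trans p identityʳ))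
  hat-apply*-injective (suc n) s {f} {g} p =
    hat-injective s a (apply-injective s (hat-natural s a f) (hat-natural s a g)
      (↝-unique (applied f) (applied g) applied≈) unit)
    where
    applied : ∀ h → Denotes (s ⊙ a) a ((h ⊗₁ id) ⨾ app) (λ Z → hat s a h (A ⊗₀ Z) ⨾ apply Z)
    applied h = ↝-◁ a (↝-refl {s = s} {t = a}) ⨾↝ app↝
    applied≈ : (f ⊗₁ id) ⨾ app ≈ (g ⊗₁ id) ⨾ app
    applied≈ = hat-apply*-injective n (s ⊙ a) (begin
      _ ≈⟨ h₁₁ (at (applied f) _) ⟩
      _ ≈⟨ assoc ⟩
      _ ≈⟨ p ⟩
      _ ≈⟨ assoc ⟨
      _ ≈⟨ h₁₁ (at (applied g) _) ⟨
      _ ∎)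

  curry* : ∀ n (s : Shape P) {k v} → Denotes (s ⊙ pw n) a k v →
           Σ (obj s ⇒ A) λ f → ∀ Z → hat s a f (Aⁿ n Z) ⨾ apply* n Z ≈ v Z
  curry* zero s {k} k↝ = ru⇐ _ ⨾ k , λ Z →
    ≈-trans identityʳ (at (ru⁻¹↝ s ˢ⨾↝ denotes {s = s ⊙ ∅} {t = a} (at k↝)) Z)
  curry* (suc n) s {k} {v} k↝
    with curry* n (s ⊙ a) (α↝ s a (pw n) ˢ⨾↝ ↝-▷ˢ s (cons↝ n) ˢ⨾↝ k↝)
  ... | f , f≈ = proj₁ curried , λ Z → begin
    hat s a (proj₁ curried) (Aⁿ (suc n) Z) ⨾ apply (Aⁿ n Z) ⨾ apply* n Z  ≈⟨ h₂₁ (β _) ⟩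
    hat (s ⊙ a) a f (Aⁿ n Z) ⨾ apply* n Z                                 ≈⟨ f≈ Z ⟩
    v Z                                                                   ∎
    where
    curried : ∃ λ g → Denotes s a g (λ Z → act₁ s (coev Z) ⨾ hat (s ⊙ a) a f (D ⊗₀ Z) ⨾ fold Z)
    curried = _ , (ru⁻¹↝ s ˢ⨾↝ ↝-▷ s η↝ ⨾↝ α⁻¹↝ s a d ˢ⨾↝ ↝-◁ d ↝-refl ⨾↝ φ↝)
    β : ∀ Z → hat s a (proj₁ curried) (A ⊗₀ Z) ⨾ apply Z ≈ hat (s ⊙ a) a f Z
    β Z = begin
      hat s a (proj₁ curried) (A ⊗₀ Z) ⨾ apply Z
        ≈⟨ h₁₁ (at (proj₂ curried) _) ⟩
      (act₁ s (coev (A ⊗₀ Z)) ⨾ hat (s ⊙ a) a f (D ⊗₀ A ⊗₀ Z) ⨾ fold (A ⊗₀ Z)) ⨾ apply Z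
        ≈⟨ ≈-trans assoc (⨾⟨ assoc) ⟩
      act₁ s (coev (A ⊗₀ Z)) ⨾ hat (s ⊙ a) a f (D ⊗₀ A ⊗₀ Z) ⨾ fold (A ⊗₀ Z) ⨾ apply Z
        ≈⟨ ⨾⟨ ⨾⟨ fold-apply Z ⟩
      act₁ s (coev (A ⊗₀ Z)) ⨾ hat (s ⊙ a) a f (D ⊗₀ A ⊗₀ Z) ⨾ A ▷ ev Z
        ≈⟨ ⨾⟨ hat-natural (s ⊙ a) a f _ ⟨
      act₁ s (coev (A ⊗₀ Z)) ⨾ act₁ s (A ▷ ev Z) ⨾ hat (s ⊙ a) a f Z
        ≈⟨ h₂₀ (act₂₀ s (coev-ev Z)) ⟩
      hat (s ⊙ a) a f Z ∎

  ⟪_⟫ : Elem → ∀ Z → Z ⇒ (A ⊗₀ Z)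
  ⟪_⟫ = hat ∅ a

  -- Left multiplication x · –.
  left : Elem → ∀ Z → (A ⊗₀ Z) ⇒ (A ⊗₀ Z)
  left x Z = ⟪ x ⟫ (A ⊗₀ Z) ⨾ apply Z

  ⟪⟫↝ : ∀ {x} → Denotes ∅ a x ⟪ x ⟫
  ⟪⟫↝ = ↝-refl

  ⟪⟫-natural : ∀ x {X Y} (f : X ⇒ Y) → f ⨾ ⟪ x ⟫ Y ≈ ⟪ x ⟫ X ⨾ A ▷ f
  ⟪⟫-natural x = hat-natural ∅ a x

  left-natural : ∀ x {X Y} (f : X ⇒ Y) → A ▷ f ⨾ left x Y ≈ left x X ⨾ A ▷ f
  left-natural x f =
    ≈-trans (h₂₂ (⟪⟫-natural x _)) (≈-trans (⨾⟨ apply-natural f) (≈-sym assoc))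

  left-injective : ∀ {x y} → (∀ Z → left x Z ≈ left y Z) → x ≈ y
  left-injective {x} {y} p =
    hat-injective ∅ a (apply-injective ∅ (⟪⟫-natural x) (⟪⟫-natural y) p unit)

  ⟪⟫-resp : ∀ {x y} → x ≈ y → ∀ Z → ⟪ x ⟫ Z ≈ ⟪ y ⟫ Z
  ⟪⟫-resp = ↝-unique ⟪⟫↝ ⟪⟫↝

  left-resp : ∀ {x y} → x ≈ y → ∀ Z → left x Z ≈ left y Z
  left-resp p Z = h₁₁ (⟪⟫-resp p _)

  ⟪·⟫ : ∀ x y Z → ⟪ x · y ⟫ Z ≈ ⟪ y ⟫ Z ⨾ left x Z
  ⟪·⟫ x y Z = ≈-trans (at (lu⁻¹↝ ∅ ˢ⨾↝ (⟪⟫↝ ⊗↝ ⟪⟫↝) ⨾↝ app↝) Z) assoc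

  left-· : ∀ x y Z → left (x · y) Z ≈ ⟪ y ⟫ (A ⊗₀ Z) ⨾ left x (A ⊗₀ Z) ⨾ apply Z
  left-· x y Z = h₁₂ (⟪·⟫ x y _)

  -- The map taking `(y , w₁ … wₙ)` to `x y w₁ … wₙ`; the index does not count the leading argument
  -- `y`.
  uncurried : Elem → ∀ n Z → (A ⊗₀ Aⁿ n Z) ⇒ (A ⊗₀ Z)
  uncurried x n Z = left x (Aⁿ n Z) ⨾ apply* n Z

  power : ∀ m n → pow m ⇒ pow n → ∀ Z → Aⁿ m Z ⇒ Aⁿ n Z
  power m n = hat (pw m) (pw n)

  -- Braid and twist are trivial at `unit`, so a closed element passes both freely and the cap of
  -- the trace acts on it as the plain `ev`.
  rev-⟪⟫ : ∀ x Z → ⟪ x ⟫ (D ⊗₀ Z) ⨾ rev Z ≈ D ▷ ⟪ x ⟫ Z ⨾ ev Z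
  rev-⟪⟫ x Z = begin
    ⟪ x ⟫ (D ⊗₀ Z) ⨾ braid a d Z ⨾ D ▷ twist a Z ⨾ ev Z   ≈⟨ h₂₂ (braid-slideˡ ⟪⟫↝ d Z) ⟩
    braid ∅ d Z ⨾ D ▷ ⟪ x ⟫ Z ⨾ D ▷ twist a Z ⨾ ev Z      ≈⟨ h₁₀ (braid-∅ˡ d Z) ⟩
    D ▷ ⟪ x ⟫ Z ⨾ D ▷ twist a Z ⨾ ev Z                    ≈⟨ h₂₁ (▷₂₁ untwisted) ⟩
    D ▷ ⟪ x ⟫ Z ⨾ ev Z                                    ∎
    where
    untwisted : ⟪ x ⟫ Z ⨾ twist a Z ≈ ⟪ x ⟫ Z
    untwisted = ≈-trans (twist-slide ⟪⟫↝ Z) (h₁₀ (twist-∅ Z))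

  F↝ : ∀ m n (f : pow m ⇒ pow n) → Denotes ∅ a (F m n f) (λ Z →
    coev Z ⨾ abstr* (suc m) (D ⊗₀ Z) ⨾ A ▷ (A ▷ power m n f (D ⊗₀ Z) ⨾ apply* n (D ⊗₀ Z)) ⨾ A ▷ rev Z)
  F↝ m n f = Tr↝
    (lu↝ a ˢ⨾↝ lam↝* m ⨾↝ uncons↝ m ˢ⨾↝ (lam↝ ⊗↝ ↝-refl) ⨾↝ α↝ a a (pw n)
       ˢ⨾↝ ↝-▷ˢ a (cons↝ n) ˢ⨾↝ ↝-▷ a (app↝* n))
    ↝≈ λ Z → ⨾⟨ ≈-trans (h₁₁ (rearranged _)) assoc
    where
    rearranged : ∀ Z →
      abstr* m Z ⨾ (A ▷ power m n f Z ⨾ abstr (Aⁿ n Z)) ⨾ A ▷ apply* n Z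
        ≈ abstr* (suc m) Z ⨾ A ▷ (A ▷ power m n f Z ⨾ apply* n Z)
    rearranged Z = begin
      abstr* m Z ⨾ (A ▷ power m n f Z ⨾ abstr (Aⁿ n Z)) ⨾ A ▷ apply* n Z
        ≈⟨ ⨾⟨ h₁₂ (abstr-natural _) ⟩
      abstr* m Z ⨾ abstr (Aⁿ m Z) ⨾ A ▷ A ▷ power m n f Z ⨾ A ▷ apply* n Z
        ≈⟨ ⨾⟨ ⨾⟨ ≈-sym ▷-⨾ ⟩
      abstr* m Z ⨾ abstr (Aⁿ m Z) ⨾ A ▷ (A ▷ power m n f Z ⨾ apply* n Z)
        ≈⟨ assoc ⟨
      abstr* (suc m) Z ⨾ A ▷ (A ▷ power m n f Z ⨾ apply* n Z) ∎

  -- The trace is not evaluated directly. `curry*` first produces an `x` with the desired uncurried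
  -- form; writing the body of `F` as `x` applied to all its variables lets every abstraction meet
  -- an application, and the trace collapses to `x`.
  uncurried-F : ∀ m n (f : pow m ⇒ pow n) Z →
                uncurried (F m n f) m Z ≈ A ▷ power m n f Z ⨾ apply* n Z
  uncurried-F m n f Z = begin
    uncurried (F m n f) m Z
      ≈⟨ h₁₁ (left-resp F≈x _) ⟩
    uncurried x m Z
      ≈⟨ assoc ⟩
    ⟪ x ⟫ (Aⁿ (suc m) Z) ⨾ apply* (suc m) Z
      ≈⟨ x≈ Z ⟩
    A ▷ power m n f Z ⨾ apply* n Z ∎
    where
    body = curry* (suc m) ∅
      (lu↝ (pw (suc m)) ˢ⨾↝ uncons↝ m ˢ⨾↝ ↝-▷ a (↝-refl {f = f}) ⨾↝ cons↝ n ˢ⨾↝ app↝* n)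
    x = proj₁ body
    x≈ = proj₂ body
    F≈x : F m n f ≈ x
    F≈x = hat-injective ∅ a (≈-trans (at (F↝ m n f) unit) (begin
      coev I ⨾ abstr* (suc m) DI ⨾ A ▷ (A ▷ power m n f DI ⨾ apply* n DI) ⨾ A ▷ rev I
        ≈⟨ ⨾⟨ ⨾⟨ h₁₁ (▷-resp (≈-sym (x≈ DI))) ⟩
      coev I ⨾ abstr* (suc m) DI ⨾ A ▷ (⟪ x ⟫ (Aⁿ (suc m) DI) ⨾ apply* (suc m) DI) ⨾ A ▷ rev I
        ≈⟨ ⨾⟨ ⨾⟨ h₁₂ ▷-⨾ ⟩
      coev I ⨾ abstr* (suc m) DI ⨾ A ▷ ⟪ x ⟫ (Aⁿ (suc m) DI) ⨾ A ▷ apply* (suc m) DI ⨾ A ▷ rev I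
        -- There are `suc m` pairs because `F` abstracts over the leading `y` as well; the middle
        -- part inserts `x`.
        ≈⟨ abstr-apply* (suc m) (λ Z → A ▷ ⟪ x ⟫ Z) (λ g → ▷₂₂ (⟪⟫-natural x g)) I ⟩
      coev I ⨾ A ▷ ⟪ x ⟫ DI ⨾ A ▷ rev I
        ≈⟨ ⨾⟨ ≈-trans (▷₂₁ (rev-⟪⟫ x I)) ▷-⨾ ⟩
      coev I ⨾ A ▷ D ▷ ⟪ x ⟫ I ⨾ A ▷ ev I
        ≈⟨ h₂₂ (≈-sym (coev-natural _)) ⟩
      ⟪ x ⟫ I ⨾ coev (A ⊗₀ I) ⨾ A ▷ ev I
        ≈⟨ ≈-trans (⨾⟨ coev-ev I) identityʳ ⟩
      ⟪ x ⟫ I ∎))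
      where
      I = unit
      DI = D ⊗₀ unit

-- Arity as linearity

module Arity {o ℓ e} (R : RibbonCategory o ℓ e) (RA : ReflexiveObject R) where
  open RibbonOps R hiding (twist)
  open ReflexiveObject RA
  open Internal R RA
  open CategoryReasoning category
  open HomReasoning
  open Strictification monoidal
  open Braiding R
  open Duality R A
  open Reflexive R RA
  open Combinators R RA

  uncurried-injective : ∀ m {x y} → uncurried x m unit ≈ uncurried y m unit → x ≈ y
  uncurried-injective m p =
    hat-apply*-injective (suc m) ∅ (≈-trans (≈-sym assoc) (≈-trans p assoc))

  left-𝐈 : ∀ Z → left 𝐈 Z ≈ id
  left-𝐈 Z = begin
    left 𝐈 Z                       ≈⟨ identityʳ ⟨
    left 𝐈 Z ⨾ id                  ≈⟨ uncurried-F 0 0 id Z ⟩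
    A ▷ power 0 0 id Z ⨾ id        ≈⟨ identityʳ ⟩
    A ▷ power 0 0 id Z             ≈⟨ ▷-resp (at (↝-id (pw 0)) Z) ⟩
    A ▷ id                         ≈⟨ ⊗-identity ⟩
    id                             ∎

  left-𝐁 : ∀ Z → left 𝐁 (A ⊗₀ A ⊗₀ Z) ⨾ apply (A ⊗₀ Z) ⨾ apply Z ≈ A ▷ apply Z ⨾ apply Z
  left-𝐁 Z = begin
    left 𝐁 (A ⊗₀ A ⊗₀ Z) ⨾ apply (A ⊗₀ Z) ⨾ apply Z   ≈⟨ ⨾⟨ ⨾⟨ identityʳ ⟨
    uncurried 𝐁 2 Z                                    ≈⟨ uncurried-F 2 1 app Z ⟩
    A ▷ power 2 1 app Z ⨾ apply Z ⨾ id                 ≈⟨ ▷-resp (at app↝ Z) ⟩⨾⟨ identityʳ ⟩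
    A ▷ apply Z ⨾ apply Z                              ∎

  left-𝐂⁺ : ∀ Z → left 𝐂⁺ (A ⊗₀ A ⊗₀ Z) ⨾ apply (A ⊗₀ Z) ⨾ apply Z
                  ≈ A ▷ braid a a Z ⨾ apply (A ⊗₀ Z) ⨾ apply Z
  left-𝐂⁺ Z = begin
    left 𝐂⁺ (A ⊗₀ A ⊗₀ Z) ⨾ apply (A ⊗₀ Z) ⨾ apply Z        ≈⟨ ⨾⟨ ⨾⟨ identityʳ ⟨
    uncurried 𝐂⁺ 2 Z                                         ≈⟨ uncurried-F 2 2 (σ A A) Z ⟩
    A ▷ braid a a Z ⨾ apply (A ⊗₀ Z) ⨾ apply Z ⨾ id          ≈⟨ ⨾⟨ ⨾⟨ identityʳ ⟩
    A ▷ braid a a Z ⨾ apply (A ⊗₀ Z) ⨾ apply Z               ∎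

  left-𝐁· : ∀ x Z → left (𝐁 · x) (A ⊗₀ Z) ⨾ apply Z ≈ apply Z ⨾ left x Z
  left-𝐁· x Z = begin
    left (𝐁 · x) (A ⊗₀ Z) ⨾ apply Z
      ≈⟨ h₁₃ (left-· 𝐁 x _) ⟩
    ⟪ x ⟫ (A ⊗₀ A ⊗₀ Z) ⨾ left 𝐁 (A ⊗₀ A ⊗₀ Z) ⨾ apply (A ⊗₀ Z) ⨾ apply Z
      ≈⟨ ⨾⟨ left-𝐁 Z ⟩
    ⟪ x ⟫ (A ⊗₀ A ⊗₀ Z) ⨾ A ▷ apply Z ⨾ apply Z
      ≈⟨ h₂₂ (≈-sym (⟪⟫-natural x _)) ⟩
    apply Z ⨾ left x Z ∎

  left-○ : ∀ x y Z → left (x ○ y) Z ≈ left y Z ⨾ left x Z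
  left-○ x y Z = begin
    left (x ○ y) Z                                              ≈⟨ left-· (𝐁 · x) y Z ⟩
    ⟪ y ⟫ (A ⊗₀ Z) ⨾ left (𝐁 · x) (A ⊗₀ Z) ⨾ apply Z            ≈⟨ ⨾⟨ left-𝐁· x Z ⟩
    ⟪ y ⟫ (A ⊗₀ Z) ⨾ apply Z ⨾ left x Z                         ≈⟨ assoc ⟨
    left y Z ⨾ left x Z                                         ∎

  -- Evaluation at `x`: `𝐂⁺` exchanges the two arguments of `𝐈`, and the crossing is trivial because
  -- `x` is closed.
  left-• : ∀ x Z → left (x •) Z ≈ A ▷ ⟪ x ⟫ Z ⨾ apply Z
  left-• x Z = begin
    left (𝐂⁺ · 𝐈 · x) Z
      ≈⟨ left-· (𝐂⁺ · 𝐈) x Z ⟩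
    ⟪ x ⟫ (A ⊗₀ Z) ⨾ left (𝐂⁺ · 𝐈) (A ⊗₀ Z) ⨾ apply Z
      ≈⟨ ⨾⟨ h₁₃ (left-· 𝐂⁺ 𝐈 _) ⟩
    ⟪ x ⟫ (A ⊗₀ Z) ⨾ ⟪ 𝐈 ⟫ (A ⊗₀ A ⊗₀ Z) ⨾ left 𝐂⁺ (A ⊗₀ A ⊗₀ Z) ⨾ apply (A ⊗₀ Z) ⨾ apply Z
      ≈⟨ ⨾⟨ ⨾⟨ left-𝐂⁺ Z ⟩
    ⟪ x ⟫ (A ⊗₀ Z) ⨾ ⟪ 𝐈 ⟫ (A ⊗₀ A ⊗₀ Z) ⨾ A ▷ braid a a Z ⨾ apply (A ⊗₀ Z) ⨾ apply Z
      ≈⟨ ⨾⟨ h₂₂ (≈-sym (⟪⟫-natural 𝐈 _)) ⟩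
    ⟪ x ⟫ (A ⊗₀ Z) ⨾ braid a a Z ⨾ ⟪ 𝐈 ⟫ (A ⊗₀ A ⊗₀ Z) ⨾ apply (A ⊗₀ Z) ⨾ apply Z
      ≈⟨ ⨾⟨ ⨾⟨ h₂₀ (left-𝐈 _) ⟩
    ⟪ x ⟫ (A ⊗₀ Z) ⨾ braid a a Z ⨾ apply Z
      ≈⟨ h₂₂ (braid-slideˡ ⟪⟫↝ a Z) ⟩
    braid ∅ a Z ⨾ A ▷ ⟪ x ⟫ Z ⨾ apply Z
      ≈⟨ h₁₀ (braid-∅ˡ a Z) ⟩
    A ▷ ⟪ x ⟫ Z ⨾ apply Z ∎

  ○-resp : ∀ {x x′ y y′} → x ≈ x′ → y ≈ y′ → x ○ y ≈ x′ ○ y′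
  ○-resp {x} {x′} {y} {y′} p q = left-injective λ Z → begin
    left (x ○ y) Z           ≈⟨ left-○ x y Z ⟩
    left y Z ⨾ left x Z      ≈⟨ left-resp q Z ⟩⨾⟨ left-resp p Z ⟩
    left y′ Z ⨾ left x′ Z    ≈⟨ left-○ x′ y′ Z ⟨
    left (x′ ○ y′) Z         ∎

  ○-identityˡ : ∀ x → 𝐈 ○ x ≈ x
  ○-identityˡ x = left-injective λ Z →
    ≈-trans (left-○ 𝐈 x Z) (≈-trans (⨾⟨ left-𝐈 Z) identityʳ)

  ○-identityʳ : ∀ x → x ○ 𝐈 ≈ x
  ○-identityʳ x = left-injective λ Z → ≈-trans (left-○ x 𝐈 Z) (h₁₀ (left-𝐈 Z))

  -- compose n corresponds to (y , z) ↦ λ w₁ … wₙ. y (z w₁ … wₙ).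
  compose : ∀ n Z → (A ⊗₀ A ⊗₀ Z) ⇒ (A ⊗₀ Z)
  compose n Z = left (𝐁 ^ n) (A ⊗₀ Z) ⨾ apply Z

  compose-natural : ∀ n {X Y} (f : X ⇒ Y) → A ▷ A ▷ f ⨾ compose n Y ≈ compose n X ⨾ A ▷ f
  compose-natural n f =
    ≈-trans (h₂₂ (left-natural (𝐁 ^ n) _)) (≈-trans (⨾⟨ apply-natural f) (≈-sym assoc))

  compose-suc : ∀ n Z → left (𝐁 ^ suc n) (A ⊗₀ A ⊗₀ Z) ⨾ apply (A ⊗₀ Z) ⨾ apply Z
                        ≈ A ▷ apply Z ⨾ compose n Z
  compose-suc n Z = begin
    left (𝐁 ○ 𝐁 ^ n) (A ⊗₀ A ⊗₀ Z) ⨾ apply (A ⊗₀ Z) ⨾ apply Z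
      ≈⟨ h₁₂ (left-○ 𝐁 (𝐁 ^ n) _) ⟩
    left (𝐁 ^ n) (A ⊗₀ A ⊗₀ Z) ⨾ left 𝐁 (A ⊗₀ A ⊗₀ Z) ⨾ apply (A ⊗₀ Z) ⨾ apply Z
      ≈⟨ ⨾⟨ left-𝐁 Z ⟩
    left (𝐁 ^ n) (A ⊗₀ A ⊗₀ Z) ⨾ A ▷ apply Z ⨾ apply Z
      ≈⟨ h₂₂ (≈-sym (left-natural (𝐁 ^ n) _)) ⟩
    A ▷ apply Z ⨾ left (𝐁 ^ n) (A ⊗₀ Z) ⨾ apply Z ∎

  compose-apply* : ∀ n Z → compose n (Aⁿ n Z) ⨾ apply* n Z ≈ A ▷ apply* n Z ⨾ apply Z
  compose-apply* zero Z = begin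
    (left 𝐈 (A ⊗₀ Z) ⨾ apply Z) ⨾ id    ≈⟨ identityʳ ⟩
    left 𝐈 (A ⊗₀ Z) ⨾ apply Z           ≈⟨ h₁₁ (≈-trans (left-𝐈 _) (≈-sym ⊗-identity)) ⟩
    A ▷ id ⨾ apply Z                    ∎
  compose-apply* (suc n) Z = begin
    compose (suc n) (A ⊗₀ W) ⨾ apply W ⨾ apply* n Z    ≈⟨ h₂₂ (≈-trans assoc (compose-suc n W)) ⟩
    A ▷ apply W ⨾ compose n W ⨾ apply* n Z             ≈⟨ ⨾⟨ compose-apply* n Z ⟩
    A ▷ apply W ⨾ A ▷ apply* n Z ⨾ apply Z             ≈⟨ h₂₁ (▷₂₁ ≈-refl) ⟩
    A ▷ (apply W ⨾ apply* n Z) ⨾ apply Z               ∎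
    where W = Aⁿ n Z

  module _ (m n : ℕ) (x : Elem) where
    -- `x •` supplies `x` as second argument to `𝐁 ^ suc m`. One of the `suc m` factors is spent on
    -- applying `x` to its own argument, which leaves `compose m`.
    arity-lhs : ∀ Z → left ((x •) ○ (𝐁 ^ suc m)) (A ⊗₀ Z) ⨾ apply Z ≈ A ▷ left x Z ⨾ compose m Z
    arity-lhs Z = begin
      left ((x •) ○ (𝐁 ^ suc m)) (A ⊗₀ Z) ⨾ apply Z
        ≈⟨ h₁₂ (left-○ (x •) (𝐁 ^ suc m) _) ⟩
      left (𝐁 ^ suc m) (A ⊗₀ Z) ⨾ left (x •) (A ⊗₀ Z) ⨾ apply Z
        ≈⟨ ⨾⟨ h₁₂ (left-• x _) ⟩
      left (𝐁 ^ suc m) (A ⊗₀ Z) ⨾ A ▷ ⟪ x ⟫ (A ⊗₀ Z) ⨾ apply (A ⊗₀ Z) ⨾ apply Z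
        ≈⟨ h₂₂ (≈-sym (left-natural (𝐁 ^ suc m) _)) ⟩
      A ▷ ⟪ x ⟫ (A ⊗₀ Z) ⨾ left (𝐁 ^ suc m) (A ⊗₀ A ⊗₀ Z) ⨾ apply (A ⊗₀ Z) ⨾ apply Z
        ≈⟨ ⨾⟨ compose-suc m Z ⟩
      A ▷ ⟪ x ⟫ (A ⊗₀ Z) ⨾ A ▷ apply Z ⨾ compose m Z
        ≈⟨ h₂₁ (▷₂₁ ≈-refl) ⟩
      A ▷ left x Z ⨾ compose m Z ∎

    arity-rhs : ∀ Z → left ((𝐁 · x) ○ (𝐁 ^ n)) (A ⊗₀ Z) ⨾ apply Z ≈ compose n Z ⨾ left x Z
    arity-rhs Z = begin
      left ((𝐁 · x) ○ (𝐁 ^ n)) (A ⊗₀ Z) ⨾ apply Z               ≈⟨ h₁₂ (left-○ (𝐁 · x) (𝐁 ^ n) _) ⟩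
      left (𝐁 ^ n) (A ⊗₀ Z) ⨾ left (𝐁 · x) (A ⊗₀ Z) ⨾ apply Z    ≈⟨ ⨾⟨ left-𝐁· x Z ⟩
      left (𝐁 ^ n) (A ⊗₀ Z) ⨾ apply Z ⨾ left x Z                ≈⟨ assoc ⟨
      compose n Z ⨾ left x Z                                    ∎

    lhs-uncurried : ∀ Z → (A ▷ left x (Aⁿ m Z) ⨾ compose m (Aⁿ m Z)) ⨾ apply* m Z
                          ≈ A ▷ uncurried x m Z ⨾ apply Z
    lhs-uncurried Z = begin
      (A ▷ left x (Aⁿ m Z) ⨾ compose m (Aⁿ m Z)) ⨾ apply* m Z    ≈⟨ assoc ⟩
      A ▷ left x (Aⁿ m Z) ⨾ compose m (Aⁿ m Z) ⨾ apply* m Z      ≈⟨ ⨾⟨ compose-apply* m Z ⟩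
      A ▷ left x (Aⁿ m Z) ⨾ A ▷ apply* m Z ⨾ apply Z             ≈⟨ h₂₁ (▷₂₁ ≈-refl) ⟩
      A ▷ uncurried x m Z ⨾ apply Z                              ∎

    -- x has arity m → n precisely when uncurried x m is linear for the left action of A on itself.
    Linear : Set (o ⊔ e)
    Linear = ∀ Z → A ▷ uncurried x m Z ⨾ apply Z ≈ compose n (Aⁿ m Z) ⨾ uncurried x m Z

    arity⇒linear : HasArity m n x → Linear
    arity⇒linear p Z = begin
      A ▷ uncurried x m Z ⨾ apply Z
        ≈⟨ lhs-uncurried Z ⟨
      (A ▷ left x (Aⁿ m Z) ⨾ compose m (Aⁿ m Z)) ⨾ apply* m Z
        ≈⟨ h₁₁ (≈-trans (≈-sym (arity-lhs _)) (≈-trans (h₁₁ (left-resp p _)) (arity-rhs _))) ⟩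
      (compose n (Aⁿ m Z) ⨾ left x (Aⁿ m Z)) ⨾ apply* m Z
        ≈⟨ assoc ⟩
      compose n (Aⁿ m Z) ⨾ uncurried x m Z ∎

    -- Linearity is the arity equation applied to m + 2 arguments. Extensionality strips them again:
    -- m in `square`, one by `apply-injective` and the last by `left-injective`.
    linear⇒arity : Linear → HasArity m n x
    linear⇒arity p = left-injective (apply-injective a (left-natural _) (left-natural _) λ Z → begin
      left ((x •) ○ (𝐁 ^ suc m)) (A ⊗₀ Z) ⨾ apply Z  ≈⟨ arity-lhs Z ⟩
      A ▷ left x Z ⨾ compose m Z                     ≈⟨ square Z ⟩
      compose n Z ⨾ left x Z                         ≈⟨ arity-rhs Z ⟨
      left ((𝐁 · x) ○ (𝐁 ^ n)) (A ⊗₀ Z) ⨾ apply Z    ∎)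
      where
      square : ∀ Z → A ▷ left x Z ⨾ compose m Z ≈ compose n Z ⨾ left x Z
      square = apply*-injective m (a ⊙ a)
        (λ f → ≈-trans (h₂₂ (▷₂₂ (left-natural x f)))
                 (≈-trans (⨾⟨ compose-natural m f) (≈-sym assoc)))
        (λ f → ≈-trans (h₂₂ (compose-natural n f))
                 (≈-trans (⨾⟨ left-natural x f) (≈-sym assoc)))
        (λ Z → ≈-trans (lhs-uncurried Z) (≈-trans (p Z) (≈-sym assoc)))

  -- Both sides amount to `z (y v₁ … vₙ)` with the `v`s produced by `f`: the map `f` touches only
  -- the trailing arguments, and `𝐁 ^ n` is the composition that hands n arguments on to `y`.
  F-linear : ∀ m n (f : pow m ⇒ pow n) → Linear m n (F m n f)
  F-linear m n f Z = begin
    A ▷ uncurried (F m n f) m Z ⨾ apply Z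
      ≈⟨ h₁₁ (≈-trans (▷-resp (uncurried-F m n f Z)) ▷-⨾) ⟩
    (A ▷ A ▷ power m n f Z ⨾ A ▷ apply* n Z) ⨾ apply Z
      ≈⟨ assoc ⟩
    A ▷ A ▷ power m n f Z ⨾ A ▷ apply* n Z ⨾ apply Z
      ≈⟨ ⨾⟨ compose-apply* n Z ⟨
    A ▷ A ▷ power m n f Z ⨾ compose n (Aⁿ n Z) ⨾ apply* n Z
      ≈⟨ h₂₂ (compose-natural n _) ⟩
    compose n (Aⁿ m Z) ⨾ A ▷ power m n f Z ⨾ apply* n Z
      ≈⟨ ⨾⟨ uncurried-F m n f Z ⟨
    compose n (Aⁿ m Z) ⨾ uncurried (F m n f) m Z ∎

  F-resp : ∀ m n {f g : pow m ⇒ pow n} → f ≈ g → F m n f ≈ F m n g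
  F-resp m n {f} {g} p = uncurried-injective m (begin
    uncurried (F m n f) m unit              ≈⟨ uncurried-F m n f unit ⟩
    A ▷ power m n f unit ⨾ apply* n unit    ≈⟨ h₁₁ (▷-resp (⨾⟨ h₁₁ (◁-resp p))) ⟩
    A ▷ power m n g unit ⨾ apply* n unit    ≈⟨ uncurried-F m n g unit ⟨
    uncurried (F m n g) m unit              ∎)

  F-id : ∀ m → F m m (id {pow m}) ≈ 𝐈
  F-id m = uncurried-injective m (begin
    uncurried (F m m id) m unit             ≈⟨ uncurried-F m m id unit ⟩
    A ▷ power m m id unit ⨾ apply* m unit   ≈⟨ h₁₁ (▷-resp (at (↝-id (pw m)) unit)) ⟩
    A ▷ id ⨾ apply* m unit                  ≈⟨ h₁₁ (≈-trans ⊗-identity (≈-sym (left-𝐈 _))) ⟩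
    uncurried 𝐈 m unit                      ∎)

  F-⨾ : ∀ l m n (f : pow l ⇒ pow m) (g : pow m ⇒ pow n) → F l n (f ⨾ g) ≈ F l m f ○ F m n g
  F-⨾ l m n f g = uncurried-injective l (begin
    uncurried (F l n (f ⨾ g)) l unit
      ≈⟨ uncurried-F l n (f ⨾ g) unit ⟩
    A ▷ power l n (f ⨾ g) unit ⨾ apply* n unit
      ≈⟨ h₁₂ (≈-trans (▷-resp (at (↝-refl {s = pw l} {t = pw m} ⨾↝ ↝-refl {t = pw n}) unit)) ▷-⨾) ⟩
    A ▷ power l m f unit ⨾ A ▷ power m n g unit ⨾ apply* n unit
      ≈⟨ ⨾⟨ uncurried-F m n g unit ⟨
    A ▷ power l m f unit ⨾ left (F m n g) (Aⁿ m unit) ⨾ apply* m unit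
      -- `F m n g` acts on the leading strand and `f` on the others. Interchanging them produces the
      -- order of `left-○`, where the right factor acts first.
      ≈⟨ h₂₂ (left-natural (F m n g) _) ⟩
    left (F m n g) (Aⁿ l unit) ⨾ A ▷ power l m f unit ⨾ apply* m unit
      ≈⟨ ⨾⟨ uncurried-F l m f unit ⟨
    left (F m n g) (Aⁿ l unit) ⨾ left (F l m f) (Aⁿ l unit) ⨾ apply* l unit
      ≈⟨ h₂₁ (≈-sym (left-○ _ _ _)) ⟩
    uncurried (F l m f ○ F m n g) l unit ∎)

-- The inverse of `F` on hom-sets

module Readback {o ℓ e} (R : RibbonCategory o ℓ e) (RA : ReflexiveObject R)
                (trace≈id : Internal.TraceCondition R RA) where
  open RibbonOps R hiding (twist)
  open ReflexiveObject RA
  open Internal R RA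
  open CategoryReasoning category
  open HomReasoning
  open Strictification monoidal
  open Braiding R
  open Duality R A
  open Reflexive R RA
  open Combinators R RA
  open Arity R RA

  -- The circle `Tr id` without its last factor `ev`, hence a section of `ev` under the trace
  -- condition.
  lcoev : ∀ Z → Z ⇒ (D ⊗₀ A ⊗₀ Z)
  lcoev Z = coev Z ⨾ braid a d Z ⨾ D ▷ twist a Z

  lcoev-natural : ∀ {X Y} (f : X ⇒ Y) → f ⨾ lcoev Y ≈ lcoev X ⨾ D ▷ A ▷ f
  lcoev-natural = ↝-natural (η↝ ⨾↝ σ↝ a d ⨾↝ ↝-▷ d (θ↝ a))

  lcoev-ev : ∀ Z → lcoev Z ⨾ ev Z ≈ id
  lcoev-ev Z = begin
    (coev Z ⨾ braid a d Z ⨾ D ▷ twist a Z) ⨾ ev Z  ≈⟨ ≈-trans assoc (⨾⟨ assoc) ⟩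
    coev Z ⨾ rev Z                                 ≈⟨ ⨾⟨ identityˡ ⟨
    coev Z ⨾ id ⨾ rev Z
      ≈⟨ ↝-unique (Tr↝ {s = ∅} {t = ∅} (↝-id (∅ ⊙ a))) (↝-id ∅) trace≈id Z ⟩
    id                                             ∎

  -- The curried form of lcoev: K-apply* below characterises it.
  K : ∀ n Z → Z ⇒ Aⁿ n (D ⊗₀ A ⊗₀ Z)
  K zero Z = lcoev Z
  K (suc n) Z = coev Z ⨾ A ▷ (K n (D ⊗₀ Z) ⨾ act₁ (pw n) (D ▷ fold Z))

  K-natural : ∀ n {X Y} (f : X ⇒ Y) → f ⨾ K n Y ≈ K n X ⨾ act₁ (pw n) (D ▷ A ▷ f)
  K-natural zero f = lcoev-natural f
  K-natural (suc n) {X} {Y} f = begin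
    f ⨾ coev Y ⨾ A ▷ (K n (D ⊗₀ Y) ⨾ act₁ (pw n) (D ▷ fold Y))
      ≈⟨ h₂₂ (coev-natural f) ⟩
    coev X ⨾ A ▷ D ▷ f ⨾ A ▷ (K n (D ⊗₀ Y) ⨾ act₁ (pw n) (D ▷ fold Y))
      ≈⟨ ⨾⟨ ▷₂₂ inner ⟩
    coev X ⨾ A ▷ (K n (D ⊗₀ X) ⨾ act₁ (pw n) (D ▷ fold X)) ⨾ A ▷ act₁ (pw n) (D ▷ A ▷ f)
      ≈⟨ ⨾⟨ ⨾⟨ act₁-suc n _ ⟨
    coev X ⨾ A ▷ (K n (D ⊗₀ X) ⨾ act₁ (pw n) (D ▷ fold X)) ⨾ act₁ (pw (suc n)) (D ▷ A ▷ f)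
      ≈⟨ assoc ⟨
    K (suc n) X ⨾ act₁ (pw (suc n)) (D ▷ A ▷ f) ∎
    where
    inner : D ▷ f ⨾ K n (D ⊗₀ Y) ⨾ act₁ (pw n) (D ▷ fold Y)
            ≈ (K n (D ⊗₀ X) ⨾ act₁ (pw n) (D ▷ fold X)) ⨾ act₁ (pw n) (D ▷ A ▷ f)
    inner = begin
      D ▷ f ⨾ K n (D ⊗₀ Y) ⨾ act₁ (pw n) (D ▷ fold Y)
        ≈⟨ h₂₂ (K-natural n _) ⟩
      K n (D ⊗₀ X) ⨾ act₁ (pw n) (D ▷ A ▷ D ▷ f) ⨾ act₁ (pw n) (D ▷ fold Y)
        ≈⟨ ⨾⟨ act₂₂ (pw n) (▷₂₂ (↝-natural φ↝ f)) ⟩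
      K n (D ⊗₀ X) ⨾ act₁ (pw n) (D ▷ fold X) ⨾ act₁ (pw n) (D ▷ A ▷ f)
        ≈⟨ assoc ⟨
      _ ∎

  -- The cups in `K` put n strands `A` in front and fold their partners `D` into the last `A`.
  -- Applying that `A` to n arguments unfolds the `D`s, and the snake equation carries each argument
  -- along its cup to the front.
  K-apply* : ∀ n Z → K n (Aⁿ n Z) ⨾ act₁ (pw n) (D ▷ apply* n Z) ≈ act₁ (pw n) (lcoev Z)
  K-apply* zero Z = ≈-trans (⨾⟨ ⊗-identity) identityʳ
  K-apply* (suc n) Z = begin
    (coev (A ⊗₀ W) ⨾ A ▷ (K n (D ⊗₀ A ⊗₀ W) ⨾ act₁ (pw n) (D ▷ fold (A ⊗₀ W))))
      ⨾ act₁ (pw (suc n)) (D ▷ (apply W ⨾ apply* n Z))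
      ≈⟨ ≈-trans assoc (⨾⟨ ⨾⟨ act₁-suc n _) ⟩
    coev (A ⊗₀ W) ⨾ A ▷ (K n (D ⊗₀ A ⊗₀ W) ⨾ act₁ (pw n) (D ▷ fold (A ⊗₀ W)))
      ⨾ A ▷ act₁ (pw n) (D ▷ (apply W ⨾ apply* n Z))
      ≈⟨ ⨾⟨ ▷₂₂ inner ⟩
    coev (A ⊗₀ W) ⨾ A ▷ ev W ⨾ A ▷ act₁ (pw n) (lcoev Z)
      ≈⟨ h₂₀ (coev-ev W) ⟩
    A ▷ act₁ (pw n) (lcoev Z)
      ≈⟨ act₁-suc n _ ⟨
    act₁ (pw (suc n)) (lcoev Z) ∎
    where
    W = Aⁿ n Z
    inner : (K n (D ⊗₀ A ⊗₀ W) ⨾ act₁ (pw n) (D ▷ fold (A ⊗₀ W)))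
              ⨾ act₁ (pw n) (D ▷ (apply W ⨾ apply* n Z))
            ≈ ev W ⨾ act₁ (pw n) (lcoev Z)
    inner = begin
      (K n (D ⊗₀ A ⊗₀ W) ⨾ act₁ (pw n) (D ▷ fold (A ⊗₀ W)))
        ⨾ act₁ (pw n) (D ▷ (apply W ⨾ apply* n Z))
        ≈⟨ assoc ⟩
      K n (D ⊗₀ A ⊗₀ W) ⨾ act₁ (pw n) (D ▷ fold (A ⊗₀ W))
        ⨾ act₁ (pw n) (D ▷ (apply W ⨾ apply* n Z))
        ≈⟨ ⨾⟨ act₂₂ (pw n) (▷₂₂ (h₂₁ (fold-apply W))) ⟩
      K n (D ⊗₀ A ⊗₀ W) ⨾ act₁ (pw n) (D ▷ A ▷ ev W) ⨾ act₁ (pw n) (D ▷ apply* n Z)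
        ≈⟨ h₂₂ (≈-sym (K-natural n _)) ⟩
      ev W ⨾ K n W ⨾ act₁ (pw n) (D ▷ apply* n Z)
        ≈⟨ ⨾⟨ K-apply* n Z ⟩
      ev W ⨾ act₁ (pw n) (lcoev Z) ∎

  -- Every element of `A` thus becomes a left multiple whose right factor is an output of `K`. By
  -- extensionality it suffices to supply n arguments: `K-apply*` hands them to the leading strand,
  -- and the remaining `lcoev` cancels against the `ev` obtained from `fold-apply`.
  K-compose : ∀ n Z →
    A ▷ K n Z ⨾ apply* n (D ⊗₀ A ⊗₀ Z) ⨾ fold (A ⊗₀ Z) ⨾ compose n Z ≈ id
  K-compose n = apply*-injective n a T-natural
    (λ f → ≈-trans identityʳ (≈-sym identityˡ)) λ Z → begin
      (A ▷ K n (Aⁿ n Z) ⨾ apply* n _ ⨾ fold _ ⨾ compose n (Aⁿ n Z)) ⨾ apply* n Z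
        ≈⟨ ≈-trans assoc (⨾⟨ ≈-trans assoc (⨾⟨ assoc)) ⟩
      A ▷ K n (Aⁿ n Z) ⨾ apply* n _ ⨾ fold _ ⨾ compose n (Aⁿ n Z) ⨾ apply* n Z
        ≈⟨ ⨾⟨ ⨾⟨ ⨾⟨ compose-apply* n Z ⟩
      A ▷ K n (Aⁿ n Z) ⨾ apply* n _ ⨾ fold _ ⨾ A ▷ apply* n Z ⨾ apply Z
        ≈⟨ ⨾⟨ ⨾⟨ h₂₂ (≈-sym (↝-natural φ↝ _)) ⟩
      A ▷ K n (Aⁿ n Z) ⨾ apply* n _ ⨾ A ▷ D ▷ apply* n Z ⨾ fold (A ⊗₀ Z) ⨾ apply Z
        ≈⟨ ⨾⟨ ⨾⟨ ⨾⟨ fold-apply Z ⟩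
      A ▷ K n (Aⁿ n Z) ⨾ apply* n _ ⨾ A ▷ D ▷ apply* n Z ⨾ A ▷ ev Z
        ≈⟨ ⨾⟨ h₂₂ (≈-sym (apply*-natural n _)) ⟩
      A ▷ K n (Aⁿ n Z) ⨾ A ▷ act₁ (pw n) (D ▷ apply* n Z) ⨾ apply* n _ ⨾ A ▷ ev Z
        ≈⟨ h₂₁ (▷₂₁ (K-apply* n Z)) ⟩
      A ▷ act₁ (pw n) (lcoev Z) ⨾ apply* n _ ⨾ A ▷ ev Z
        ≈⟨ h₂₂ (apply*-natural n _) ⟩
      apply* n Z ⨾ A ▷ lcoev Z ⨾ A ▷ ev Z
        ≈⟨ ⨾⟨ ▷₂₀ (lcoev-ev Z) ⟩
      apply* n Z ⨾ id
        ≈⟨ ≈-trans identityʳ (≈-sym identityˡ) ⟩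
      id ⨾ apply* n Z ∎
    where
    T-natural : ∀ {X Y} (f : X ⇒ Y) →
      A ▷ f ⨾ A ▷ K n Y ⨾ apply* n (D ⊗₀ A ⊗₀ Y) ⨾ fold (A ⊗₀ Y) ⨾ compose n Y
        ≈ (A ▷ K n X ⨾ apply* n (D ⊗₀ A ⊗₀ X) ⨾ fold (A ⊗₀ X) ⨾ compose n X) ⨾ A ▷ f
    T-natural {X} {Y} f = begin
      A ▷ f ⨾ A ▷ K n Y ⨾ apply* n _ ⨾ fold (A ⊗₀ Y) ⨾ compose n Y
        ≈⟨ h₂₂ (▷₂₂ (K-natural n f)) ⟩
      A ▷ K n X ⨾ A ▷ act₁ (pw n) (D ▷ A ▷ f) ⨾ apply* n _ ⨾ fold (A ⊗₀ Y) ⨾ compose n Y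
        ≈⟨ ⨾⟨ h₂₂ (apply*-natural n _) ⟩
      A ▷ K n X ⨾ apply* n _ ⨾ A ▷ D ▷ A ▷ f ⨾ fold (A ⊗₀ Y) ⨾ compose n Y
        ≈⟨ ⨾⟨ ⨾⟨ h₂₂ (↝-natural φ↝ _) ⟩
      A ▷ K n X ⨾ apply* n _ ⨾ fold (A ⊗₀ X) ⨾ A ▷ A ▷ f ⨾ compose n Y
        ≈⟨ ⨾⟨ ⨾⟨ ⨾⟨ compose-natural n f ⟩
      A ▷ K n X ⨾ apply* n _ ⨾ fold (A ⊗₀ X) ⨾ compose n X ⨾ A ▷ f
        ≈⟨ ≈-trans assoc (⨾⟨ ≈-trans assoc (⨾⟨ assoc)) ⟨
      (A ▷ K n X ⨾ apply* n _ ⨾ fold (A ⊗₀ X) ⨾ compose n X) ⨾ A ▷ f ∎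

  -- `K n` yields the n outputs together with a pair in `D ⊗ A`. The `A` becomes the leading
  -- argument of `uncurried x`, and the `D` is evaluated on the result.
  readback : ∀ m n → Elem → ∀ Z → Aⁿ m Z ⇒ Aⁿ n Z
  readback m n x Z = K n (Aⁿ m Z) ⨾ act₁ (pw n) (D ▷ uncurried x m Z ⨾ ev Z)

  G : ∀ m n → Elem → pow m ⇒ pow n
  G m n x = unhat (pw m) (pw n) (readback m n x unit)

  power-G : ∀ m n x → power m n (G m n x) unit ≈ readback m n x unit
  power-G m n x = hat-unhat (pw m) (pw n) _

  G-resp : ∀ m n {x y} → x ≈ y → G m n x ≈ G m n y
  G-resp m n {x} {y} p = hat-injective (pw m) (pw n) (begin
    power m n (G m n x) unit   ≈⟨ power-G m n x ⟩
    readback m n x unit        ≈⟨ ⨾⟨ act-resp (pw n) (h₁₁ (▷-resp (h₁₁ (left-resp p _)))) ⟩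
    readback m n y unit        ≈⟨ power-G m n y ⟨
    power m n (G m n y) unit   ∎)

  -- Naturality of `K` brings `f` to the front; by `K-apply*` only the circle `lcoev ⨾ ev` is left
  -- behind it.
  readback-F : ∀ m n f Z → readback m n (F m n f) Z ≈ power m n f Z
  readback-F m n f Z = begin
    K n (Aⁿ m Z) ⨾ act₁ (pw n) (D ▷ uncurried (F m n f) m Z ⨾ ev Z)
      ≈⟨ ⨾⟨ act₁₃ (pw n) (h₁₂ (≈-trans (▷-resp (uncurried-F m n f Z)) ▷-⨾)) ⟩
    K n (Aⁿ m Z) ⨾ act₁ (pw n) (D ▷ A ▷ power m n f Z) ⨾ act₁ (pw n) (D ▷ apply* n Z)
      ⨾ act₁ (pw n) (ev Z)
      ≈⟨ h₂₂ (≈-sym (K-natural n _)) ⟩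
    power m n f Z ⨾ K n (Aⁿ n Z) ⨾ act₁ (pw n) (D ▷ apply* n Z) ⨾ act₁ (pw n) (ev Z)
      ≈⟨ ⨾⟨ h₂₁ (K-apply* n Z) ⟩
    power m n f Z ⨾ act₁ (pw n) (lcoev Z) ⨾ act₁ (pw n) (ev Z)
      ≈⟨ ⨾⟨ act₂₀ (pw n) (lcoev-ev Z) ⟩
    power m n f Z ⨾ id
      ≈⟨ identityʳ ⟩
    power m n f Z ∎

  G-F : ∀ m n f → G m n (F m n f) ≈ f
  G-F m n f = hat-injective (pw m) (pw n) (≈-trans (power-G m n _) (readback-F m n f unit))

  -- Read backwards: `K-compose` expands the leading strand into a left multiple, linearity pulls
  -- the multiplier out of `uncurried x`, and the fold in the multiplier meets the application as
  -- `ev`.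
  readback-linear : ∀ m n x → Linear m n x →
                    ∀ Z → A ▷ readback m n x Z ⨾ apply* n Z ≈ uncurried x m Z
  readback-linear m n x linear Z = begin
    A ▷ (K n V ⨾ act₁ (pw n) (D ▷ uncurried x m Z ⨾ ev Z)) ⨾ apply* n Z
      ≈⟨ h₁₂ ▷-⨾ ⟩
    A ▷ K n V ⨾ A ▷ act₁ (pw n) (D ▷ uncurried x m Z ⨾ ev Z) ⨾ apply* n Z
      ≈⟨ ⨾⟨ apply*-natural n _ ⟩
    A ▷ K n V ⨾ apply* n _ ⨾ A ▷ (D ▷ uncurried x m Z ⨾ ev Z)
      ≈⟨ ⨾⟨ ⨾⟨ ▷-⨾ ⟩
    A ▷ K n V ⨾ apply* n _ ⨾ A ▷ D ▷ uncurried x m Z ⨾ A ▷ ev Z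
      ≈⟨ ⨾⟨ ⨾⟨ ⨾⟨ fold-apply Z ⟨
    A ▷ K n V ⨾ apply* n _ ⨾ A ▷ D ▷ uncurried x m Z ⨾ fold (A ⊗₀ Z) ⨾ apply Z
      ≈⟨ ⨾⟨ ⨾⟨ h₂₂ (↝-natural φ↝ _) ⟩
    A ▷ K n V ⨾ apply* n _ ⨾ fold (A ⊗₀ V) ⨾ A ▷ uncurried x m Z ⨾ apply Z
      ≈⟨ ⨾⟨ ⨾⟨ ⨾⟨ linear Z ⟩
    A ▷ K n V ⨾ apply* n _ ⨾ fold (A ⊗₀ V) ⨾ compose n V ⨾ uncurried x m Z
      ≈⟨ ≈-trans assoc (⨾⟨ ≈-trans assoc (⨾⟨ assoc)) ⟨
    (A ▷ K n V ⨾ apply* n _ ⨾ fold (A ⊗₀ V) ⨾ compose n V) ⨾ uncurried x m Z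
      ≈⟨ h₁₀ (K-compose n V) ⟩
    uncurried x m Z ∎
    where V = Aⁿ m Z

  F-G : ∀ m n x → HasArity m n x → F m n (G m n x) ≈ x
  F-G m n x p = uncurried-injective m (begin
    uncurried (F m n (G m n x)) m unit                 ≈⟨ uncurried-F m n (G m n x) unit ⟩
    A ▷ power m n (G m n x) unit ⨾ apply* n unit       ≈⟨ h₁₁ (▷-resp (power-G m n x)) ⟩
    A ▷ readback m n x unit ⨾ apply* n unit
      ≈⟨ readback-linear m n x (arity⇒linear m n x p) unit ⟩
    uncurried x m unit                                 ∎)

  F-faithful : ∀ m n {f g : pow m ⇒ pow n} → F m n f ≈ F m n g → f ≈ g
  F-faithful m n {f} {g} p =
    ≈-trans (≈-sym (G-F m n f)) (≈-trans (G-resp m n p) (G-F m n g))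

  𝐈-arity : ∀ n → HasArity n n 𝐈
  𝐈-arity n = linear⇒arity n n 𝐈 λ Z → begin
    A ▷ (left 𝐈 (Aⁿ n Z) ⨾ apply* n Z) ⨾ apply Z        ≈⟨ h₁₁ (▷-resp (h₁₀ (left-𝐈 _))) ⟩
    A ▷ apply* n Z ⨾ apply Z                            ≈⟨ compose-apply* n Z ⟨
    compose n (Aⁿ n Z) ⨾ apply* n Z                     ≈⟨ ⨾⟨ h₁₀ (left-𝐈 _) ⟨
    compose n (Aⁿ n Z) ⨾ left 𝐈 (Aⁿ n Z) ⨾ apply* n Z   ∎

  -- `F` is the identity on indices and bijective on hom-sets, so its inverse serves as the
  -- quasi-inverse and both natural isomorphisms are identities.
  equivalenceF : IsEquivalenceF
  equivalenceF = record
    { G₀ = λ n → n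
    ; G₁ = λ m n x _ → G m n x
    ; G-resp-≈ = λ {m} {n} _ _ → G-resp m n
    ; G-identity = λ n _ → ≈-trans (G-resp n n (≈-sym (F-id n))) (G-F n n id)
    -- Obtained from functoriality of `F` by faithfulness.
    ; G-homomorphism = λ {l} {m} {n} {x} {y} p q r → F-faithful l n (begin
        F l n (G l n (x ○ y))                  ≈⟨ F-G l n (x ○ y) r ⟩
        x ○ y                                  ≈⟨ ○-resp (F-G l m x p) (F-G m n y q) ⟨
        F l m (G l m x) ○ F m n (G m n y)      ≈⟨ F-⨾ l m n _ _ ⟨
        F l n (G l m x ⨾ G m n y)              ∎)
    ; unitη = λ _ → id
    ; unitη⁻¹ = λ _ → id
    ; unitη-isoˡ = λ _ → identityˡ
    ; unitη-isoʳ = λ _ → identityˡ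
    ; unitη-natural = λ {m} {n} f _ → ≈-trans identityʳ (≈-sym (≈-trans identityˡ (G-F m n f)))
    ; counit = λ _ → 𝐈
    ; counit-arity = 𝐈-arity
    ; counit⁻¹ = λ _ → 𝐈
    ; counit⁻¹-arity = 𝐈-arity
    ; counit-isoˡ = λ _ → ○-identityˡ 𝐈
    ; counit-isoʳ = λ _ → ○-identityˡ 𝐈
    ; counit-natural = λ {m} {n} x p →
        ≈-trans (○-identityʳ _) (≈-trans (F-G m n x p) (≈-sym (○-identityˡ x)))
    }

theorem6p10 : ∀ {o ℓ e} (R : RibbonCategory o ℓ e) (RA : ReflexiveObject R) →
    Internal.TraceCondition R RA → Internal.Conclusion R RA
theorem6p10 R RA trace≈id = record
  { F-arity = λ {m} {n} f → linear⇒arity m n _ (F-linear m n f)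
  ; F-resp-≈ = λ {m} {n} → F-resp m n
  ; F-identity = F-id
  ; F-homomorphism = λ {l} {m} {n} → F-⨾ l m n
  ; faithful = λ {m} {n} _ _ → F-faithful m n
  ; full = λ {m} {n} x p → G m n x , F-G m n x p
  ; equivalence = equivalenceF
  }
  where
  open Arity R RA
  open Readback R RA trace≈id
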